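{- Let $R$ be a Dedekind domain and let $I$ be a nonzero ideal of $R$ such that $R/I$ is finite and nontrivial. For any positive integer $m$, the number of cliques of order $m$ (sets of $m$ pairwise adjacent vertices) in the graph $G_{R/I}$ is \[\prod_{k=1}^m\frac{\mathcal{S}_{k-1}(R/I)}{k}.\]
   Context: For a commutative ring $X$ with unity, the unitary Cayley graph $G_X$ has vertex set $X$ and edge set $\{\{a,b\}: a-b\in U(X)\}$, where $U(X)$ is the unit group. For a nonnegative integer $r$ and nonzero ideals $I$ of $R$ with $R/I$ finite, $\mathcal{S}_r(R/I)$ is defined by: (a) $\mathcal{S}_r(R/R)=1$; (b) for a prime ideal $P$ of finite index and positive integer $\alpha$, $\mathcal{S}_r(R/P^\alpha)=|R/P|^{\alpha-1}(|R/P|-r)$ if $r\le |R/P|$ and $0$ if $r>|R/P|$; (c) $\mathcal{S}_r(R/AB)=\mathcal{S}_r(R/A)\mathcal{S}_r(R/B)$ for relatively prime nonzero ideals $A,B$ of finite index. -}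

module Defs where

open import Level using (Level; _⊔_; Lift) renaming (suc to lsuc)
open import Algebra.Bundles using (CommutativeRing)
open import Data.Nat as ℕ using (ℕ; zero; suc; _≤ᵇ_; _∸_; _≤_)
open import Data.Fin using (Fin)
open import Data.Fin.Properties using (any?) renaming (_≟_ to _≟ᶠ_)
open import Data.List as List using (List; []; _∷_; _++_; length; filter; allFin)
open import Data.List.Relation.Unary.AllPairs using (AllPairs; allPairs?)
open import Data.List.Relation.Unary.All using (All)
open import Data.Product using (Σ; ∃; _×_; _,_; proj₁; proj₂; ∃-syntax)
open import Data.Sum using (_⊎_)
open import Data.Unit using (⊤)
open import Data.Bool using (if_then_else_)
open import Relation.Nullary using (¬_; Dec)
open import Relation.Binary.PropositionalEquality using (_≡_)

-- all sublists of xs of length m (each m-subset of a duplicate-free list once)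
choose : ∀ {a} {A : Set a} → List A → ℕ → List (List A)
choose xs       zero    = [] ∷ []
choose []       (suc m) = []
choose (x ∷ xs) (suc m) = List.map (x ∷_) (choose xs m) ++ choose xs (suc m)

prod1to : ℕ → (ℕ → ℕ) → ℕ
prod1to zero    f = 1
prod1to (suc m) f = prod1to m f ℕ.* f (suc m)

module _ {c ℓ} (R : CommutativeRing c ℓ) where
  open CommutativeRing R

  record Ideal : Set (lsuc (c ⊔ ℓ)) where
    field
      mem  : Carrier → Set (c ⊔ ℓ)
      resp : ∀ {x y} → x ≈ y → mem x → mem y
      0∈   : mem 0#
      +∈   : ∀ {x y} → mem x → mem y → mem (x + y)
      *∈   : ∀ r {x} → mem x → mem (r * x)
  open Ideal public

  SubsetR : Set (lsuc (c ⊔ ℓ))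
  SubsetR = Carrier → Set (c ⊔ ℓ)

  _⊆ᵣ_ : SubsetR → SubsetR → Set (c ⊔ ℓ)
  A ⊆ᵣ B = ∀ x → A x → B x

  _≐ᵣ_ : SubsetR → SubsetR → Set (c ⊔ ℓ)
  A ≐ᵣ B = (A ⊆ᵣ B) × (B ⊆ᵣ A)

  wholeR : SubsetR
  wholeR _ = Lift (c ⊔ ℓ) ⊤

  sumProd : List (Carrier × Carrier) → Carrier
  sumProd []             = 0#
  sumProd ((a , b) ∷ ps) = a * b + sumProd ps

  _·ᵣ_ : SubsetR → SubsetR → SubsetR
  (A ·ᵣ B) x = ∃[ ps ] (All (λ p → A (proj₁ p) × B (proj₂ p)) ps × x ≈ sumProd ps)

  powᵣ : SubsetR → ℕ → SubsetR
  powᵣ P zero    = wholeR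
  powᵣ P (suc α) = P ·ᵣ powᵣ P α

  Nonzero : Ideal → Set (c ⊔ ℓ)
  Nonzero I = ∃[ x ] (mem I x × ¬ (x ≈ 0#))

  Proper : Ideal → Set (c ⊔ ℓ)
  Proper I = ¬ mem I 1#

  IsPrime : Ideal → Set (c ⊔ ℓ)
  IsPrime P = Proper P × (∀ a b → mem P (a * b) → mem P a ⊎ mem P b)

  IsMaximal : Ideal → Set (lsuc (c ⊔ ℓ))
  IsMaximal P = Proper P × (∀ (J : Ideal) → mem P ⊆ᵣ mem J → (mem J ⊆ᵣ mem P) ⊎ mem J 1#)

  IsIntegralDomain : Set (c ⊔ ℓ)
  IsIntegralDomain = ¬ (1# ≈ 0#) × (∀ a b → a * b ≈ 0# → a ≈ 0# ⊎ b ≈ 0#)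

  Generated : List Carrier → Carrier → Set (c ⊔ ℓ)
  Generated []       x = Lift (c ⊔ ℓ) (x ≈ 0#)
  Generated (g ∷ gs) x = ∃[ r ] ∃[ y ] (Generated gs y × x ≈ r * g + y)

  IsNoetherian : Set (lsuc (c ⊔ ℓ))
  IsNoetherian = ∀ (I : Ideal) → ∃[ gs ] (mem I ⊆ᵣ Generated gs × Generated gs ⊆ᵣ mem I)

  powR : Carrier → ℕ → Carrier
  powR x zero    = 1#
  powR x (suc n) = x * powR x n

  -- b^n · f(a/b) for the monic polynomial f(X) = X^n + c_{n-1}X^{n-1} + … + c_0,
  -- coefficients given as the list c_0 ∷ … ∷ c_{n-1}
  homogMonic : Carrier → Carrier → List Carrier → Carrier
  homogMonic a b []       = 1#
  homogMonic a b (k ∷ ks) = k * powR b (suc (length ks)) + a * homogMonic a b ks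

  -- integrally closed (in the fraction field): if a/b (b ≠ 0) is a root of a
  -- monic polynomial over R, then a/b ∈ R, i.e. b ∣ a
  IsIntegrallyClosed : Set (c ⊔ ℓ)
  IsIntegrallyClosed = ∀ a b → ¬ (b ≈ 0#) → (∃[ ks ] homogMonic a b ks ≈ 0#) → ∃[ q ] a ≈ q * b

  DimAtMostOne : Set (lsuc (c ⊔ ℓ))
  DimAtMostOne = ∀ (P : Ideal) → IsPrime P → Nonzero P → IsMaximal P

  IsDedekindDomain : Set (lsuc (c ⊔ ℓ))
  IsDedekindDomain = IsIntegralDomain × IsNoetherian × IsIntegrallyClosed × DimAtMostOne

  record FiniteQuotient (I : Ideal) : Set (lsuc (c ⊔ ℓ)) where
    field
      size : ℕ
      π    : Carrier → Fin size
      surj : ∀ j → ∃[ x ] π x ≡ j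
      ker⇒ : ∀ x y → π x ≡ π y → mem I (x - y)
      ker⇐ : ∀ x y → mem I (x - y) → π x ≡ π y

    rep : Fin size → Carrier
    rep j = proj₁ (surj j)

    -- adjacency in the unitary Cayley graph G_{R/I}: (u - v) is a unit of R/I
    Adj : Fin size → Fin size → Set
    Adj u v = ∃[ z ] π ((rep u - rep v) * rep z) ≡ π 1#

    adj? : ∀ u v → Dec (Adj u v)
    adj? u v = any? (λ z → π ((rep u - rep v) * rep z) ≟ᶠ π 1#)

    cliqueCount : ℕ → ℕ
    cliqueCount m = length (filter (allPairs? adj?) (choose (allFin size) m))
  open FiniteQuotient public

  -- Prime factorisation data I = P₁^α₁ ⋯ P_s^α_s (distinct nonzero primes
  -- of finite index, αᵢ ≥ 1), and S_r(R/I) computed from it via (a)–(c).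

  record PrimePowerFactor : Set (lsuc (c ⊔ ℓ)) where
    field
      prime    : Ideal
      isPrime  : IsPrime prime
      nonzero  : Nonzero prime
      exponent : ℕ
      exp≥1    : 1 ≤ exponent
      finite   : FiniteQuotient prime
  open PrimePowerFactor public

  productOf : List PrimePowerFactor → SubsetR
  productOf []       = wholeR
  productOf (f ∷ fs) = powᵣ (mem (prime f)) (exponent f) ·ᵣ productOf fs

  DistinctPrimes : PrimePowerFactor → PrimePowerFactor → Set (c ⊔ ℓ)
  DistinctPrimes f g = ¬ (mem (prime f) ≐ᵣ mem (prime g))

  record Factorisation (I : Ideal) : Set (lsuc (c ⊔ ℓ)) where
    field
      factors  : List PrimePowerFactor
      distinct : AllPairs DistinctPrimes factors
      equal    : mem I ≐ᵣ productOf factors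
  open Factorisation public

  -- (b): S_r(R/P^α) = |R/P|^(α-1) (|R/P| - r) if r ≤ |R/P|, else 0
  Sfactor : ℕ → PrimePowerFactor → ℕ
  Sfactor r f = if r ≤ᵇ q then q ℕ.^ (exponent f ∸ 1) ℕ.* (q ∸ r) else 0
    where q = size (finite f)

  -- (a),(c): multiplicativity over the factorisation (empty product = 1)
  S : ℕ → List PrimePowerFactor → ℕ
  S r []       = 1
  S r (f ∷ fs) = Sfactor r f ℕ.* S r fs

{-# OPTIONS --safe #-}
module Submission where

-- Counting pairs of an (m+1)-clique and one of its vertices gives
-- (m+1) c(m+1) = c(m) S_m once every m-clique of G_{R/I} is known to have S_m common
-- neighbours.  By the Chinese remainder theorem this number is multiplicative in I, and an
-- element is a unit mod P^α iff it lies outside P, so that modulo P^α there are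
-- |P/P^α| (|R/P| - m) common neighbours: the residues mod P of the m vertices are distinct
-- and have to be avoided.  Finally |P/P^α| = |R/P|^(α-1) because P is locally principal:
-- there are t ∈ P and s ∉ P with sP ⊆ tR, so the elements a + tⁱb, with a and b running
-- through representatives of R/Pⁱ and R/P, represent R/Pⁱ⁺¹.
--
-- Complete residue systems L of J are lists with ∑_{y ∈ L} [x ≡ y] = 1 for all x, which
-- turns every comparison of two systems into an exchange of sums.  The classical ideal
-- theory is available constructively since noetherianity of all ideals implies excluded
-- middle.

open import Defs
open import Level using (Level; _⊔_; Lift; lift)
open import Algebra.Bundles using (CommutativeRing)
open import Data.Nat as ℕ using (ℕ; zero; suc; _≤_; _≤ᵇ_; _∸_; _^_; _!; s≤s)
import Data.Nat.Properties as ℕₚ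
open import Data.Nat.Tactic.RingSolver using (solve-∀)
open import Data.Bool using (true; false; T)
open import Data.Fin as Fin using (Fin)
import Data.Fin.Properties as Finₚ
open import Data.List using (List; []; _∷_; _++_; length; map; filter; allFin; cartesianProductWith)
open import Data.List.Properties using (length-map; length-tabulate; map-tabulate)
open import Data.List.Relation.Unary.All as All using (All; []; _∷_)
import Data.List.Relation.Unary.All.Properties as Allₚ
open import Data.List.Relation.Unary.AllPairs as AllPairs using (AllPairs; []; _∷_; allPairs?)
import Data.List.Relation.Unary.AllPairs.Properties as AllPairsₚ
open import Data.List.Relation.Binary.Permutation.Propositional as Perm using (_↭_)
import Data.List.Relation.Binary.Permutation.Setoid.Properties as Permₛ
open import Data.Product using (Σ; ∃; _×_; _,_; proj₁; proj₂; ∃-syntax)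
open import Data.Sum using (_⊎_; inj₁; inj₂; [_,_]′)
open import Data.Unit using (tt)
open import Data.Empty using (⊥)
open import Function using (_∘_; id)
open import Relation.Nullary using (¬_; Dec; yes; no; contradiction)
open import Relation.Unary using (Decidable)
open import Relation.Binary.Definitions using (WeaklyDecidable)
import Data.Integer as ℤ
open import Data.Integer using (ℤ; -[1+_]; _⊖_)
import Data.Integer.Properties as ℤₚ
open import Data.Maybe using (just; nothing)
import Algebra.Solver.Ring
open import Algebra.Solver.Ring.AlmostCommutativeRing
  using (_-Raw-AlmostCommutative⟶_; fromCommutativeRing; Induced-equivalence)
import Algebra.Properties.Ring
import Algebra.Properties.Group
import Algebra.Properties.Semiring.Mult.TCOptimised
import Relation.Binary.Reasoning.Setoid
open import Relation.Binary.PropositionalEquality as ≡ using (_≡_; refl; cong; cong₂)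

-- Finite sums over lists, indicators and sums over m-subsets.

module FiniteSums where
  open import Data.Nat using (_+_; _*_)

  private variable
    a b p : Level
    A : Set a
    B : Set b

  ∑ : List A → (A → ℕ) → ℕ
  ∑ []       f = 0
  ∑ (x ∷ xs) f = f x + ∑ xs f

  ∑-cong : ∀ (xs : List A) {f g : A → ℕ} → (∀ x → f x ≡ g x) → ∑ xs f ≡ ∑ xs g
  ∑-cong []       e = refl
  ∑-cong (x ∷ xs) e = cong₂ _+_ (e x) (∑-cong xs e)

  ∑-cong-All : ∀ {P : A → Set p} {xs : List A} {f g : A → ℕ} → All P xs →
    (∀ {x} → P x → f x ≡ g x) → ∑ xs f ≡ ∑ xs g
  ∑-cong-All []         e = refl
  ∑-cong-All (px ∷ pxs) e = cong₂ _+_ (e px) (∑-cong-All pxs e)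

  ∑-zero : ∀ (xs : List A) → ∑ xs (λ _ → 0) ≡ 0
  ∑-zero []       = refl
  ∑-zero (x ∷ xs) = ∑-zero xs

  ∑-one : ∀ (xs : List A) → ∑ xs (λ _ → 1) ≡ length xs
  ∑-one []       = refl
  ∑-one (x ∷ xs) = cong suc (∑-one xs)

  ∑-+ : ∀ (xs : List A) (f g : A → ℕ) → ∑ xs (λ x → f x + g x) ≡ ∑ xs f + ∑ xs g
  ∑-+ []       f g = refl
  ∑-+ (x ∷ xs) f g rewrite ∑-+ xs f g = lem (f x) (g x) (∑ xs f) (∑ xs g)
    where
    lem : ∀ u v w z → u + v + (w + z) ≡ u + w + (v + z)
    lem = solve-∀

  ∑-*ˡ : ∀ (xs : List A) k (f : A → ℕ) → ∑ xs (λ x → k * f x) ≡ k * ∑ xs f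
  ∑-*ˡ []       k f = ≡.sym (ℕₚ.*-zeroʳ k)
  ∑-*ˡ (x ∷ xs) k f = ≡.trans (cong (k * f x +_) (∑-*ˡ xs k f)) (≡.sym (ℕₚ.*-distribˡ-+ k (f x) _))

  ∑-*ʳ : ∀ (xs : List A) k (f : A → ℕ) → ∑ xs (λ x → f x * k) ≡ ∑ xs f * k
  ∑-*ʳ []       k f = refl
  ∑-*ʳ (x ∷ xs) k f = ≡.trans (cong (f x * k +_) (∑-*ʳ xs k f)) (≡.sym (ℕₚ.*-distribʳ-+ k (f x) _))

  ∑-swap : ∀ (xs : List A) (ys : List B) (f : A → B → ℕ) →
    ∑ xs (λ x → ∑ ys (f x)) ≡ ∑ ys (λ y → ∑ xs (λ x → f x y))
  ∑-swap []       ys f = ≡.sym (∑-zero ys)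
  ∑-swap (x ∷ xs) ys f = ≡.trans (cong (∑ ys (f x) +_) (∑-swap xs ys f))
    (≡.sym (∑-+ ys (f x) (λ y → ∑ xs (λ x → f x y))))

  ∑-++ : ∀ (xs ys : List A) (f : A → ℕ) → ∑ (xs ++ ys) f ≡ ∑ xs f + ∑ ys f
  ∑-++ []       ys f = refl
  ∑-++ (x ∷ xs) ys f = ≡.trans (cong (f x +_) (∑-++ xs ys f)) (≡.sym (ℕₚ.+-assoc (f x) _ _))

  ∑-map : ∀ (h : A → B) (xs : List A) (f : B → ℕ) → ∑ (map h xs) f ≡ ∑ xs (f ∘ h)
  ∑-map h []       f = refl
  ∑-map h (x ∷ xs) f = cong (f (h x) +_) (∑-map h xs f)

  ∑-cartesianProductWith : ∀ {c} {C : Set c} (h : A → B → C) xs ys (f : C → ℕ) →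
    ∑ (cartesianProductWith h xs ys) f ≡ ∑ xs (λ x → ∑ ys (f ∘ h x))
  ∑-cartesianProductWith h []       ys f = refl
  ∑-cartesianProductWith h (x ∷ xs) ys f = ≡.trans (∑-++ (map (h x) ys) _ f)
    (cong₂ _+_ (∑-map (h x) ys f) (∑-cartesianProductWith h xs ys f))

  ind : Dec A → ℕ
  ind (yes _) = 1
  ind (no  _) = 0

  ind-yes : (A? : Dec A) → A → ind A? ≡ 1
  ind-yes (yes _) x = refl
  ind-yes (no ¬x) x = contradiction x ¬x

  ind-no : (A? : Dec A) → ¬ A → ind A? ≡ 0
  ind-no (yes x) ¬x = contradiction x ¬x
  ind-no (no _)  ¬x = refl

  -- Decisions of equivalent propositions come from unrelated sources (`lem`, `_≟_`, `allPairs?`),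
  -- so they are compared through the two implications only.
  ind-cong : (A? : Dec A) (B? : Dec B) → (A → B) → (B → A) → ind A? ≡ ind B?
  ind-cong (yes x) B? f g = ≡.sym (ind-yes B? (f x))
  ind-cong (no ¬x) B? f g = ≡.sym (ind-no B? (¬x ∘ g))

  ind-× : ∀ {c} {C : Set c} (A? : Dec A) (B? : Dec B) (C? : Dec C) →
    (C → A × B) → (A → B → C) → ind C? ≡ ind A? * ind B?
  ind-× (yes x) B? C? f g = ≡.trans (ind-cong C? B? (proj₂ ∘ f) (g x)) (≡.sym (ℕₚ.+-identityʳ _))
  ind-× (no ¬x) B? C? f g = ind-no C? (¬x ∘ proj₁ ∘ f)

  ∑-ind-filter : ∀ {P : A → Set p} (P? : Decidable P) xs → length (filter P? xs) ≡ ∑ xs (ind ∘ P?)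
  ∑-ind-filter P? []       = refl
  ∑-ind-filter P? (x ∷ xs) with P? x
  ... | yes _ = cong suc (∑-ind-filter P? xs)
  ... | no  _ = ∑-ind-filter P? xs

  -- Both sides count pairs of an (m+1)-subset and one of its elements; since f kills
  -- lists with a repeated entry, v may range over all of xs.
  ∑-choose-suc : ∀ {A : Set a} (f : List A → ℕ) → (∀ {xs ys} → xs ↭ ys → f xs ≡ f ys) →
    (∀ x xs → f (x ∷ x ∷ xs) ≡ 0) → ∀ xs m →
    suc m * ∑ (choose xs (suc m)) f ≡ ∑ (choose xs m) (λ C → ∑ xs (λ v → f (v ∷ C)))
  ∑-choose-suc f f-↭ f-rep []       zero    = refl
  ∑-choose-suc f f-↭ f-rep []       (suc m) = ℕₚ.*-zeroʳ m
  ∑-choose-suc f f-↭ f-rep (x ∷ xs) zero    = begin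
    1 * (f (x ∷ []) + ∑ (choose xs 1) f)
      ≡⟨ lem₁ (f (x ∷ [])) _ ⟩
    f (x ∷ []) + 1 * ∑ (choose xs 1) f
      ≡⟨ cong (f (x ∷ []) +_) (∑-choose-suc f f-↭ f-rep xs 0) ⟩
    f (x ∷ []) + (∑ xs (λ v → f (v ∷ [])) + 0)
      ≡⟨ ℕₚ.+-assoc (f (x ∷ [])) _ 0 ⟨
    f (x ∷ []) + ∑ xs (λ v → f (v ∷ [])) + 0 ∎
    where
    open ≡.≡-Reasoning
    lem₁ : ∀ u v → 1 * (u + v) ≡ u + 1 * v
    lem₁ = solve-∀
  ∑-choose-suc f f-↭ f-rep (x ∷ xs) (suc m) = begin
    suc (suc m) * ∑ (map (x ∷_) (choose xs (suc m)) ++ choose xs (suc (suc m))) f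
      ≡⟨ cong (suc (suc m) *_) (∑-++ (map (x ∷_) (choose xs (suc m))) _ f) ⟩
    suc (suc m) * (∑ (map (x ∷_) (choose xs (suc m))) f + T₂)
      ≡⟨ cong (λ k → suc (suc m) * (k + T₂)) (∑-map (x ∷_) (choose xs (suc m)) f) ⟩
    suc (suc m) * (T₁ + T₂)
      -- Of the m+2 copies of `T₁`, m+1 go to the induction hypothesis for `fₓ`; the last one
      -- supplies the term `v = x` for the subsets `C` of `xs`.
      ≡⟨ lem₁ m T₁ T₂ ⟩
    suc m * T₁ + (T₁ + suc (suc m) * T₂)
      ≡⟨ cong₂ (λ u v → u + (T₁ + v)) (∑-choose-suc fₓ (f-↭ ∘ Perm.prep x) fₓ-rep xs m)
          (∑-choose-suc f f-↭ f-rep xs (suc m)) ⟩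
    ∑ (choose xs m) (λ C → ∑ xs (λ v → f (x ∷ v ∷ C))) + (T₁ + U)
      ≡⟨ cong₂ _+_ (∑-cong (choose xs m) withˣ) (≡.sym (∑-+ (choose xs (suc m)) fₓ (λ C → ∑ xs (λ v → f (v ∷ C))))) ⟩
    ∑ (choose xs m) (λ C → g (x ∷ C)) + ∑ (choose xs (suc m)) g
      ≡⟨ cong (_+ ∑ (choose xs (suc m)) g) (∑-map (x ∷_) (choose xs m) g) ⟨
    ∑ (map (x ∷_) (choose xs m)) g + ∑ (choose xs (suc m)) g
      ≡⟨ ∑-++ (map (x ∷_) (choose xs m)) _ g ⟨
    ∑ (map (x ∷_) (choose xs m) ++ choose xs (suc m)) g ∎
    where
    open ≡.≡-Reasoning
    fₓ : List _ → ℕ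
    fₓ C = f (x ∷ C)
    g : List _ → ℕ
    g C = ∑ (x ∷ xs) (λ v → f (v ∷ C))
    T₁ T₂ U : ℕ
    T₁ = ∑ (choose xs (suc m)) fₓ
    T₂ = ∑ (choose xs (suc (suc m))) f
    U  = ∑ (choose xs (suc m)) (λ C → ∑ xs (λ v → f (v ∷ C)))
    lem₁ : ∀ m s t → suc (suc m) * (s + t) ≡ suc m * s + (s + suc (suc m) * t)
    lem₁ = solve-∀
    fₓ-rep : ∀ y ys → fₓ (y ∷ y ∷ ys) ≡ 0
    fₓ-rep y ys = ≡.trans (f-↭ (Perm.trans (Perm.swap x y Perm.refl) (Perm.prep y (Perm.swap x y Perm.refl))))
      (f-rep y (x ∷ ys))
    -- The sum in `g (x ∷ C)` also runs over `v = x`; that term vanishes because `x ∷ x ∷ C` repeats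
    -- `x`.
    withˣ : ∀ C → ∑ xs (λ v → f (x ∷ v ∷ C)) ≡ g (x ∷ C)
    withˣ C = ≡.trans (∑-cong xs (λ v → f-↭ (Perm.swap x v Perm.refl)))
      (cong (_+ ∑ xs (λ v → f (v ∷ x ∷ C))) (≡.sym (f-rep x C)))

  choose-length : ∀ {A : Set a} (xs : List A) m → All (λ C → length C ≡ m) (choose xs m)
  choose-length xs       zero    = refl ∷ []
  choose-length []       (suc m) = []
  choose-length (x ∷ xs) (suc m) =
    Allₚ.++⁺ (Allₚ.map⁺ (All.map (cong suc) (choose-length xs m))) (choose-length xs (suc m))

  ∑-allFin-≟ : ∀ {n} (i : Fin n) → ∑ (allFin n) (λ j → ind (i Finₚ.≟ j)) ≡ 1
  ∑-allFin-≟ {suc n} i = ≡.trans (cong (λ xs → ∑ (Fin.zero ∷ xs) (λ j → ind (i Finₚ.≟ j))) (≡.sym (map-tabulate id Fin.suc)))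
    (≡.trans (cong (ind (i Finₚ.≟ Fin.zero) +_) (∑-map Fin.suc (allFin n) _)) (split i))
    where
    split : ∀ i → ind (i Finₚ.≟ Fin.zero) + ∑ (allFin n) (λ j → ind (i Finₚ.≟ Fin.suc j)) ≡ 1
    split Fin.zero    = cong suc (∑-zero (allFin n))
    split (Fin.suc i) = ≡.trans (∑-cong (allFin n) λ j → ind-cong (Fin.suc i Finₚ.≟ Fin.suc j) (i Finₚ.≟ j)
      Finₚ.suc-injective (cong Fin.suc)) (∑-allFin-≟ i)

open FiniteSums

-- Integer coefficients for the ring solver.

-- With coefficients in ℤ the ring solver can cancel x - x over an abstract ring, which has
-- no decidable equality.
module IntegerCoefficients {c ℓ} (R : CommutativeRing c ℓ) where
  open import Data.Nat using (_+_)
  private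
    module R = CommutativeRing R
    open Algebra.Properties.Ring R.ring using (-‿distribˡ-*; -‿distribʳ-*; -‿involutive; -0#≈0#; -‿+-comm)
    open Algebra.Properties.Semiring.Mult.TCOptimised R.semiring
      using (×-homo-+; ×1-homo-*; 1+×) renaming (_×_ to _·_)
    open Relation.Binary.Reasoning.Setoid R.setoid

  ⟦_⟧ : ℤ → R.Carrier
  ⟦ ℤ.+ n ⟧    = n · R.1#
  ⟦ -[1+ n ] ⟧ = R.- (suc n · R.1#)

  ⟦⟧-neg : ∀ i → ⟦ ℤ.- i ⟧ R.≈ R.- ⟦ i ⟧
  ⟦⟧-neg (ℤ.+ zero)  = R.sym -0#≈0#
  ⟦⟧-neg (ℤ.+ suc n) = R.refl
  ⟦⟧-neg -[1+ n ]    = R.sym (-‿involutive _)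

  -- Integer addition of opposite signs unfolds to `_⊖_`, so both mixed cases of `⟦⟧-+` come from
  -- this one.
  ⟦⟧-⊖ : ∀ m n → ⟦ m ⊖ n ⟧ R.≈ m · R.1# R.+ R.- (n · R.1#)
  ⟦⟧-⊖ m       zero    = R.sym (R.trans (R.+-congˡ -0#≈0#) (R.+-identityʳ _))
  ⟦⟧-⊖ zero    (suc n) = R.sym (R.+-identityˡ _)
  ⟦⟧-⊖ (suc m) (suc n) = begin
    ⟦ suc m ⊖ suc n ⟧                 ≡⟨ cong ⟦_⟧ (ℤₚ.[1+m]⊖[1+n]≡m⊖n m n) ⟩
    ⟦ m ⊖ n ⟧                         ≈⟨ ⟦⟧-⊖ m n ⟩
    x R.+ R.- y                       ≈⟨ R.+-congʳ (R.+-identityˡ x) ⟨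
    R.0# R.+ x R.+ R.- y              ≈⟨ R.+-congʳ (R.+-congʳ (R.-‿inverseʳ R.1#)) ⟨
    R.1# R.+ R.- R.1# R.+ x R.+ R.- y ≈⟨ R.+-congʳ (R.+-assoc _ _ _) ⟩
    R.1# R.+ (R.- R.1# R.+ x) R.+ R.- y ≈⟨ R.+-congʳ (R.+-congˡ (R.+-comm _ _)) ⟩
    R.1# R.+ (x R.+ R.- R.1#) R.+ R.- y ≈⟨ R.+-congʳ (R.+-assoc _ _ _) ⟨
    R.1# R.+ x R.+ R.- R.1# R.+ R.- y ≈⟨ R.+-assoc _ _ _ ⟩
    R.1# R.+ x R.+ (R.- R.1# R.+ R.- y) ≈⟨ R.+-cong (R.sym (1+× m R.1#)) (-‿+-comm _ _) ⟩
    suc m · R.1# R.+ R.- (R.1# R.+ y) ≈⟨ R.+-congˡ (R.-‿cong (1+× n R.1#)) ⟨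
    suc m · R.1# R.+ R.- (suc n · R.1#) ∎
    where
    x = m · R.1#
    y = n · R.1#

  ⟦⟧-+ : ∀ i j → ⟦ i ℤ.+ j ⟧ R.≈ ⟦ i ⟧ R.+ ⟦ j ⟧
  ⟦⟧-+ (ℤ.+ m)  (ℤ.+ n)  = ×-homo-+ R.1# m n
  ⟦⟧-+ (ℤ.+ m)  -[1+ n ] = ⟦⟧-⊖ m (suc n)
  ⟦⟧-+ -[1+ m ] (ℤ.+ n)  = R.trans (⟦⟧-⊖ n (suc m)) (R.+-comm _ _)
  ⟦⟧-+ -[1+ m ] -[1+ n ] = begin
    R.- (suc (suc (m + n)) · R.1#) ≡⟨ cong (λ k → R.- (suc k · R.1#)) (ℕₚ.+-suc m n) ⟨
    R.- ((suc m + suc n) · R.1#)   ≈⟨ R.-‿cong (×-homo-+ R.1# (suc m) (suc n)) ⟩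
    R.- (suc m · R.1# R.+ suc n · R.1#) ≈⟨ -‿+-comm _ _ ⟨
    ⟦ -[1+ m ] ⟧ R.+ ⟦ -[1+ n ] ⟧ ∎

  ⟦⟧-*ⁿ : ∀ m j → ⟦ ℤ.+ m ℤ.* j ⟧ R.≈ ⟦ ℤ.+ m ⟧ R.* ⟦ j ⟧
  ⟦⟧-*ⁿ m (ℤ.+ n)  = R.trans (R.reflexive (cong ⟦_⟧ (≡.sym (ℤₚ.pos-* m n)))) (×1-homo-* m n)
  ⟦⟧-*ⁿ m -[1+ n ] = begin
    ⟦ ℤ.+ m ℤ.* (ℤ.- (ℤ.+ suc n)) ⟧   ≡⟨ cong ⟦_⟧ (ℤₚ.neg-distribʳ-* (ℤ.+ m) (ℤ.+ suc n)) ⟨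
    ⟦ ℤ.- (ℤ.+ m ℤ.* ℤ.+ suc n) ⟧     ≈⟨ ⟦⟧-neg (ℤ.+ m ℤ.* ℤ.+ suc n) ⟩
    R.- ⟦ ℤ.+ m ℤ.* ℤ.+ suc n ⟧       ≈⟨ R.-‿cong (⟦⟧-*ⁿ m (ℤ.+ suc n)) ⟩
    R.- (⟦ ℤ.+ m ⟧ R.* ⟦ ℤ.+ suc n ⟧) ≈⟨ -‿distribʳ-* _ _ ⟩
    ⟦ ℤ.+ m ⟧ R.* ⟦ -[1+ n ] ⟧        ∎

  ⟦⟧-* : ∀ i j → ⟦ i ℤ.* j ⟧ R.≈ ⟦ i ⟧ R.* ⟦ j ⟧
  ⟦⟧-* (ℤ.+ m)  j = ⟦⟧-*ⁿ m j
  ⟦⟧-* -[1+ m ] j = begin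
    ⟦ ℤ.- (ℤ.+ suc m) ℤ.* j ⟧   ≡⟨ cong ⟦_⟧ (ℤₚ.neg-distribˡ-* (ℤ.+ suc m) j) ⟨
    ⟦ ℤ.- (ℤ.+ suc m ℤ.* j) ⟧   ≈⟨ ⟦⟧-neg (ℤ.+ suc m ℤ.* j) ⟩
    R.- ⟦ ℤ.+ suc m ℤ.* j ⟧     ≈⟨ R.-‿cong (⟦⟧-*ⁿ (suc m) j) ⟩
    R.- (⟦ ℤ.+ suc m ⟧ R.* ⟦ j ⟧) ≈⟨ -‿distribˡ-* _ _ ⟩
    ⟦ -[1+ m ] ⟧ R.* ⟦ j ⟧      ∎

  homomorphism : ℤ.+-*-rawRing -Raw-AlmostCommutative⟶ fromCommutativeRing R
  homomorphism = record
    { ⟦_⟧ = ⟦_⟧ ; +-homo = ⟦⟧-+ ; *-homo = ⟦⟧-* ; -‿homo = ⟦⟧-neg ; 0-homo = R.refl ; 1-homo = R.refl }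

  -- Distinct integers may have the same image in `R`, so inequality in ℤ can only give `nothing`.
  _≟ᶜ_ : WeaklyDecidable (Induced-equivalence homomorphism)
  i ≟ᶜ j with i ℤ.≟ j
  ... | yes i≡j = just (R.reflexive (cong ⟦_⟧ i≡j))
  ... | no  _   = nothing

  open Algebra.Solver.Ring ℤ.+-*-rawRing (fromCommutativeRing R) homomorphism _≟ᶜ_ public
    using (solve; _:=_; _:+_; _:*_; _:-_; :-_; con; Polynomial)

  :0 :1 : ∀ {n} → Polynomial n
  :0 = con (ℤ.+ 0)
  :1 = con (ℤ.+ 1)

-- Ideals: products, powers, comaximality and units modulo an ideal.

module IdealLemmas {c ℓ} (R : CommutativeRing c ℓ) where
  open CommutativeRing R hiding (zero)
    renaming (refl to ≈-refl; sym to ≈-sym; trans to ≈-trans)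
  open IntegerCoefficients R using (solve; _:=_; _:+_; _:*_; _:-_; :-_; :0; :1)

  -∈ : ∀ (J : Ideal R) {x} → mem J x → mem J (- x)
  -∈ J {x} m = resp J (solve 1 (λ x → :- :1 :* x := :- x) ≈-refl x) (*∈ J (- 1#) m)

  *∈ʳ : ∀ (J : Ideal R) r {x} → mem J x → mem J (x * r)
  *∈ʳ J r m = resp J (*-comm r _) (*∈ J r m)

  infix 4 _≡_[mod_]
  _≡_[mod_] : Carrier → Carrier → Ideal R → Set (c ⊔ ℓ)
  x ≡ y [mod J ] = mem J (x - y)

  mod-reflexive : ∀ (J : Ideal R) {x y} → x ≈ y → x ≡ y [mod J ]
  mod-reflexive J {x} {y} x≈y = resp J (≈-sym (≈-trans (+-congʳ x≈y) (-‿inverseʳ y))) (0∈ J)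

  mod-sym : ∀ (J : Ideal R) {x y} → x ≡ y [mod J ] → y ≡ x [mod J ]
  mod-sym J {x} {y} m = resp J (solve 2 (λ x y → :- (x :- y) := y :- x) ≈-refl x y) (-∈ J m)

  mod-trans : ∀ (J : Ideal R) {x y z} → x ≡ y [mod J ] → y ≡ z [mod J ] → x ≡ z [mod J ]
  mod-trans J {x} {y} {z} m n =
    resp J (solve 3 (λ x y z → (x :- y) :+ (y :- z) := x :- z) ≈-refl x y z) (+∈ J m n)

  sumProd-++ : ∀ ps qs → sumProd R (ps ++ qs) ≈ sumProd R ps + sumProd R qs
  sumProd-++ []             qs = ≈-sym (+-identityˡ _)
  sumProd-++ ((a , b) ∷ ps) qs = ≈-trans (+-congˡ (sumProd-++ ps qs)) (≈-sym (+-assoc _ _ _))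

  sumProd-scale : ∀ r ps → sumProd R (map (λ p → r * proj₁ p , proj₂ p) ps) ≈ r * sumProd R ps
  sumProd-scale r []             = ≈-sym (zeroʳ r)
  sumProd-scale r ((a , b) ∷ ps) = ≈-trans (+-congˡ (sumProd-scale r ps))
    (solve 4 (λ r a b s → r :* a :* b :+ r :* s := r :* (a :* b :+ s)) ≈-refl r a b _)

  infixl 7 _·_
  _·_ : Ideal R → Ideal R → Ideal R
  (A · B) .mem = _·ᵣ_ R (mem A) (mem B)
  (A · B) .resp x≈y (ps , all , e) = ps , all , ≈-trans (≈-sym x≈y) e
  (A · B) .0∈ = [] , [] , ≈-refl
  (A · B) .+∈ (ps , all , e) (qs , all′ , e′) =
    ps ++ qs , Allₚ.++⁺ all all′ , ≈-trans (+-cong e e′) (≈-sym (sumProd-++ ps qs))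
  (A · B) .*∈ r (ps , all , e) =
    map (λ p → r * proj₁ p , proj₂ p) ps ,
    Allₚ.map⁺ (All.map (λ (m , n) → *∈ A r m , n) all) ,
    ≈-trans (*-congˡ e) (≈-sym (sumProd-scale r ps))

  ·-intro : ∀ (A B : Ideal R) {x y} → mem A x → mem B y → mem (A · B) (x * y)
  ·-intro A B m n = _ ∷ [] , (m , n) ∷ [] , ≈-sym (+-identityʳ _)

  ·-elim : ∀ (A B J : Ideal R) → (∀ x y → mem A x → mem B y → mem J (x * y)) →
    ∀ {x} → mem (A · B) x → mem J x
  ·-elim A B J h (ps , all , e) = resp J (≈-sym e) (go ps all)
    where
    go : ∀ ps → All (λ p → mem A (proj₁ p) × mem B (proj₂ p)) ps → mem J (sumProd R ps)
    go []       []              = 0∈ J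
    go (_ ∷ ps) ((m , n) ∷ all) = +∈ J (h _ _ m n) (go ps all)

  ·⊆ˡ : ∀ (A B : Ideal R) {x} → mem (A · B) x → mem A x
  ·⊆ˡ A B = ·-elim A B A (λ x y m n → *∈ʳ A y m)

  ·⊆ʳ : ∀ (A B : Ideal R) {x} → mem (A · B) x → mem B x
  ·⊆ʳ A B = ·-elim A B B (λ x y m n → *∈ B x n)

  whole : Ideal R
  whole .mem        = wholeR R
  whole .resp _ _   = lift tt
  whole .0∈         = lift tt
  whole .+∈ _ _     = lift tt
  whole .*∈ _ _     = lift tt

  infixr 8 _^ᴵ_
  _^ᴵ_ : Ideal R → ℕ → Ideal R
  P ^ᴵ zero  = whole
  P ^ᴵ suc n = P · P ^ᴵ n

  -- Factorisations are stated with products of bare subsets; identifying the predicates themselves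
  -- allows passing to ideals and back.
  mem-^ᴵ : ∀ P n → mem (P ^ᴵ n) ≡ powᵣ R (mem P) n
  mem-^ᴵ P zero    = refl
  mem-^ᴵ P (suc n) = cong (_·ᵣ_ R (mem P)) (mem-^ᴵ P n)

  primePower : PrimePowerFactor R → Ideal R
  primePower f = prime f ^ᴵ exponent f

  ∏ : List (PrimePowerFactor R) → Ideal R
  ∏ []       = whole
  ∏ (f ∷ fs) = primePower f · ∏ fs

  mem-∏ : ∀ fs → mem (∏ fs) ≡ productOf R fs
  mem-∏ []       = refl
  mem-∏ (f ∷ fs) = cong₂ (_·ᵣ_ R) (mem-^ᴵ (prime f) (exponent f)) (mem-∏ fs)

  principal : Carrier → Ideal R
  principal x .mem y = Lift (c ⊔ ℓ) (∃[ r ] y ≈ r * x)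
  principal x .resp y≈z (lift (r , e)) = lift (r , ≈-trans (≈-sym y≈z) e)
  principal x .0∈ = lift (0# , ≈-sym (zeroˡ x))
  principal x .+∈ (lift (r , e)) (lift (s , e′)) =
    lift (r + s , ≈-trans (+-cong e e′) (≈-sym (distribʳ x r s)))
  principal x .*∈ t (lift (r , e)) = lift (t * r , ≈-trans (*-congˡ e) (≈-sym (*-assoc t r x)))

  infixl 6 _⊹_
  _⊹_ : Ideal R → Ideal R → Ideal R
  (A ⊹ B) .mem x = ∃[ a ] ∃[ b ] (mem A a × mem B b × x ≈ a + b)
  (A ⊹ B) .resp x≈y (a , b , m , n , e) = a , b , m , n , ≈-trans (≈-sym x≈y) e
  (A ⊹ B) .0∈ = 0# , 0# , 0∈ A , 0∈ B , ≈-sym (+-identityˡ 0#)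
  (A ⊹ B) .+∈ (a , b , m , n , e) (a′ , b′ , m′ , n′ , e′) =
    a + a′ , b + b′ , +∈ A m m′ , +∈ B n n′ , ≈-trans (+-cong e e′)
      (solve 4 (λ a b a′ b′ → (a :+ b) :+ (a′ :+ b′) := (a :+ a′) :+ (b :+ b′)) ≈-refl a b a′ b′)
  (A ⊹ B) .*∈ r (a , b , m , n , e) =
    r * a , r * b , *∈ A r m , *∈ B r n , ≈-trans (*-congˡ e) (distribˡ r a b)

  Comaximal : Ideal R → Ideal R → Set (c ⊔ ℓ)
  Comaximal A B = mem (A ⊹ B) 1#

  comaximal-sym : ∀ {A B} → Comaximal A B → Comaximal B A
  comaximal-sym (a , b , m , n , e) = b , a , n , m , ≈-trans e (+-comm a b)

  comaximal-whole : ∀ A → Comaximal A whole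
  comaximal-whole A = 0# , 1# , 0∈ A , lift tt , ≈-sym (+-identityˡ 1#)

  -- Multiply the two decompositions of 1: every term except `b * c′` has a factor in `A`.
  comaximal-· : ∀ A B C → Comaximal A B → Comaximal A C → Comaximal A (B · C)
  comaximal-· A B C (a , b , m , n , e) (a′ , c′ , m′ , n′ , e′) =
    a * (a′ + c′) + b * a′ , b * c′ , +∈ A (*∈ʳ A _ m) (*∈ A b m′) , ·-intro B C n n′ ,
    ≈-trans (≈-trans (≈-sym (*-identityˡ 1#)) (*-cong e e′))
      (solve 4 (λ a b a′ c → (a :+ b) :* (a′ :+ c) := (a :* (a′ :+ c) :+ b :* a′) :+ b :* c) ≈-refl a b a′ c′)

  comaximal-^ : ∀ A B n → Comaximal A B → Comaximal A (B ^ᴵ n)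
  comaximal-^ A B zero    h = comaximal-whole A
  comaximal-^ A B (suc n) h = comaximal-· A B (B ^ᴵ n) h (comaximal-^ A B n h)

  UnitMod : Ideal R → Carrier → Set (c ⊔ ℓ)
  UnitMod J x = ∃[ y ] x * y ≡ 1# [mod J ]

  unitMod-⊆ : ∀ {A B : Ideal R} → (∀ {x} → mem A x → mem B x) → ∀ {x} → UnitMod A x → UnitMod B x
  unitMod-⊆ A⊆B (y , m) = y , A⊆B m

  unitMod-resp : ∀ (J : Ideal R) {x x′} → x ≡ x′ [mod J ] → UnitMod J x → UnitMod J x′
  unitMod-resp J {x} {x′} x≡x′ (y , m) = y , resp J
    (solve 3 (λ x x′ y → (x :* y :- :1) :- (x :- x′) :* y := x′ :* y :- :1) ≈-refl x x′ y)
    (+∈ J m (-∈ J (*∈ʳ J y x≡x′)))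

  unitMod-neg : ∀ (J : Ideal R) {x y} → UnitMod J (x - y) → UnitMod J (y - x)
  unitMod-neg J {x} {y} (z , m) = - z , resp J
    (solve 3 (λ x y z → (x :- y) :* z :- :1 := (y :- x) :* (:- z) :- :1) ≈-refl x y z) m

  -- (1 - xy)(1 - xz) lies in A · B and is of the form 1 - xw.
  unitMod-· : ∀ (A B : Ideal R) {x} → UnitMod A x → UnitMod B x → UnitMod (A · B) x
  unitMod-· A B {x} (y , m) (z , n) = y + z - x * y * z , resp (A · B)
    (solve 3 (λ x y z → :- ((x :* y :- :1) :* (x :* z :- :1)) := x :* (y :+ z :- x :* y :* z) :- :1) ≈-refl x y z)
    (-∈ (A · B) (·-intro A B m n))

  unitMod-whole : ∀ x → UnitMod whole x
  unitMod-whole x = 0# , lift tt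

  unitMod-^ : ∀ P n {x} → UnitMod P x → UnitMod (P ^ᴵ n) x
  unitMod-^ P zero    {x} u = unitMod-whole x
  unitMod-^ P (suc n) u = unitMod-· P (P ^ᴵ n) u (unitMod-^ P n u)

  prime-pow∉ : ∀ P → IsPrime R P → ∀ {x} n → ¬ mem P x → ¬ mem P (powR R x n)
  prime-pow∉ P (1∉ , _) zero    x∉ m = 1∉ m
  prime-pow∉ P isP@(_ , pr) (suc n) x∉ m = [ x∉ , prime-pow∉ P isP n x∉ ]′ (pr _ _ m)

  unitMod⇒∉ : ∀ P → Proper R P → ∀ {x} → UnitMod P x → ¬ mem P x
  unitMod⇒∉ P 1∉ {x} (y , m) x∈ = 1∉ (resp P
    (solve 2 (λ x y → x :* y :- (x :* y :- :1) := :1) ≈-refl x y) (+∈ P (*∈ʳ P y x∈) (-∈ P m)))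

  -- The ideal `P ⊹ principal x` is strictly larger than `P`, so it contains 1 = p + rx, and r
  -- inverts x.
  maximal⇒unitMod : ∀ P → IsMaximal R P → ∀ {x} → ¬ mem P x → UnitMod P x
  maximal⇒unitMod P (_ , max) {x} x∉
    with max (P ⊹ principal x) (λ y m → y , 0# , m , 0∈ (principal x) , ≈-sym (+-identityʳ y))
  ... | inj₁ ⊆P = contradiction (⊆P x (0# , x , 0∈ P , lift (1# , ≈-sym (*-identityˡ x)) , ≈-sym (+-identityˡ x))) x∉
  ... | inj₂ (p , y , p∈ , lift (r , y≈rx) , 1≈p+y) = r , resp P
    (≈-sym (≈-trans (+-congˡ (-‿cong (≈-trans 1≈p+y (+-congˡ y≈rx))))
      (solve 3 (λ p r x → x :* r :- (p :+ r :* x) := :- p) ≈-refl p r x)))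
    (-∈ P p∈)

  -- Maximality of `P` leaves comaximality or `P′` inside `P`; in the second case maximality of `P′`
  -- makes the two equal or puts 1 into `P`.
  maximal-comaximal : ∀ {P P′} → IsMaximal R P → IsMaximal R P′ →
    ¬ (_≐ᵣ_ R (mem P) (mem P′)) → Comaximal P P′
  maximal-comaximal {P} {P′} (1∉P , maxP) (_ , maxP′) P≢P′
    with maxP (P ⊹ P′) (λ y m → y , 0# , m , 0∈ P′ , ≈-sym (+-identityʳ y))
  ... | inj₂ h  = h
  ... | inj₁ ⊆P with maxP′ P (λ y m → ⊆P y (0# , y , 0∈ P , m , ≈-sym (+-identityˡ y)))
  ...   | inj₁ P⊆P′ = contradiction (P⊆P′ , λ y m → ⊆P y (0# , y , 0∈ P , m , ≈-sym (+-identityˡ y))) P≢P′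
  ...   | inj₂ 1∈P  = contradiction 1∈P 1∉P

-- Excluded middle and the ascending chain condition.

module Classical {c ℓ} (R : CommutativeRing c ℓ)
  (1≉0 : ¬ CommutativeRing._≈_ R (CommutativeRing.1# R) (CommutativeRing.0# R))
  (noetherian : IsNoetherian R) where
  open CommutativeRing R hiding (zero)
    renaming (refl to ≈-refl; sym to ≈-sym; trans to ≈-trans)
  open IdealLemmas R

  generator∈ : ∀ g gs → Generated R (g ∷ gs) g
  generator∈ g gs = 1# , 0# , 0∈gen gs , ≈-sym (≈-trans (+-identityʳ _) (*-identityˡ g))
    where
    0∈gen : ∀ gs → Generated R gs 0#
    0∈gen []       = lift ≈-refl
    0∈gen (g ∷ gs) = 0# , 0# , 0∈gen gs , ≈-sym (≈-trans (+-identityʳ _) (zeroˡ g))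

  generated-∷ : ∀ g {gs x} → Generated R gs x → Generated R (g ∷ gs) x
  generated-∷ g {x = x} m = 0# , x , m , ≈-sym (≈-trans (+-congʳ (zeroˡ g)) (+-identityˡ x))

  generated⊆ : ∀ (J : Ideal R) {gs} → All (mem J) gs → ∀ {x} → Generated R gs x → mem J x
  generated⊆ J []        (lift x≈0)        = resp J (≈-sym x≈0) (0∈ J)
  generated⊆ J (g∈ ∷ gs∈) (r , y , m , e) = resp J (≈-sym e) (+∈ J (*∈ J r g∈) (generated⊆ J gs∈ m))

  generators∈ : ∀ {p} {Q : Carrier → Set p} gs → (∀ x → Generated R gs x → Q x) → All Q gs
  generators∈ []       h = []
  generators∈ (g ∷ gs) h = h g (generator∈ g gs) ∷ generators∈ gs (λ x m → h x (generated-∷ g m))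

  -- A proposition encoded as an ideal: all of `R` if `X` holds, the zero ideal if it fails.
  zeroOr : Set (c ⊔ ℓ) → Ideal R
  zeroOr X .mem x = Lift (c ⊔ ℓ) (x ≈ 0#) ⊎ X
  zeroOr X .resp x≈y = [ (λ (lift e) → inj₁ (lift (≈-trans (≈-sym x≈y) e))) , inj₂ ]′
  zeroOr X .0∈ = inj₁ (lift ≈-refl)
  zeroOr X .+∈ (inj₁ (lift e)) (inj₁ (lift e′)) = inj₁ (lift (≈-trans (+-cong e e′) (+-identityˡ 0#)))
  zeroOr X .+∈ (inj₁ _)        (inj₂ x)         = inj₂ x
  zeroOr X .+∈ (inj₂ x)        _                = inj₂ x
  zeroOr X .*∈ r = [ (λ (lift e) → inj₁ (lift (≈-trans (*-congˡ e) (zeroʳ r)))) , inj₂ ]′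

  -- A finite list of generators of zeroOr X either contains a proof of X or shows that
  -- the ideal is zero, and then X fails because it would put 1 into the ideal.
  abstract
    lem : (X : Set (c ⊔ ℓ)) → Dec X
    lem X with noetherian (zeroOr X)
    ... | gs , J⊆ , ⊆J with split (generators∈ gs ⊆J)
      where
      split : ∀ {gs} → All (mem (zeroOr X)) gs → X ⊎ All (mem (principal 0#)) gs
      split []                   = inj₂ []
      split (inj₂ x ∷ _)         = inj₁ x
      split (inj₁ (lift e) ∷ ms) with split ms
      ... | inj₁ x  = inj₁ x
      ... | inj₂ zs = inj₂ (lift (0# , ≈-trans e (≈-sym (zeroˡ 0#))) ∷ zs)
    ...   | inj₁ x  = yes x
    ...   | inj₂ zs = no λ x → case (generated⊆ (principal 0#) zs (J⊆ 1# (inj₂ x)))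
      where
      case : mem (principal 0#) 1# → ⊥
      case (lift (r , e)) = 1≉0 (≈-trans e (zeroʳ r))

  by-contradiction : ∀ {X : Set (c ⊔ ℓ)} → ¬ ¬ X → X
  by-contradiction {X} ¬¬x with lem X
  ... | yes x = x
  ... | no ¬x = contradiction ¬x ¬¬x

  module _ (J : ℕ → Ideal R) (J-mono : ∀ n {x} → mem (J n) x → mem (J (suc n)) x) where

    chain-≤ : ∀ {m n x} → m ≤ n → mem (J m) x → mem (J n) x
    chain-≤ m≤n = go (ℕₚ.≤⇒≤′ m≤n)
      where
      go : ∀ {m n x} → m ℕ.≤′ n → mem (J m) x → mem (J n) x
      go ℕ.≤′-refl      m∈ = m∈
      go (ℕ.≤′-step le) m∈ = J-mono _ (go le m∈)

    ⋃ : Ideal R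
    ⋃ .mem x = ∃[ n ] mem (J n) x
    ⋃ .resp x≈y (n , m) = n , resp (J n) x≈y m
    ⋃ .0∈ = 0 , 0∈ (J 0)
    ⋃ .+∈ (k , m) (l , n) = k ℕ.⊔ l ,
      +∈ (J (k ℕ.⊔ l)) (chain-≤ (ℕₚ.m≤m⊔n k l) m) (chain-≤ (ℕₚ.m≤n⊔m k l) n)
    ⋃ .*∈ r (n , m) = n , *∈ (J n) r m

    -- The union has finitely many generators, and these all lie in one `J n`, which is then the
    -- whole union.
    stabilises : ∃[ n ] (∀ {x} → mem (J (suc n)) x → mem (J n) x)
    stabilises with noetherian ⋃
    ... | gs , ⋃⊆ , ⊆⋃ with bound (generators∈ gs ⊆⋃)
      where
      bound : ∀ {gs} → All (mem ⋃) gs → ∃[ n ] All (mem (J n)) gs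
      bound []             = 0 , []
      bound ((k , m) ∷ ms) with bound ms
      ... | l , ns = k ℕ.⊔ l , chain-≤ (ℕₚ.m≤m⊔n k l) m ∷ All.map (chain-≤ (ℕₚ.m≤n⊔m k l)) ns
    ...   | n , gs∈ = n , λ m → generated⊆ (J n) gs∈ (⋃⊆ _ (suc n , m))

-- Nonzero primes of a Dedekind domain are locally principal.

module Uniformiser {c ℓ} (R : CommutativeRing c ℓ) (dedekind : IsDedekindDomain R) where
  open CommutativeRing R hiding (zero)
    renaming (refl to ≈-refl; sym to ≈-sym; trans to ≈-trans)
  open IntegerCoefficients R using (solve; _:=_; _:+_; _:*_; _:-_; :-_; :0; :1)
  open IdealLemmas R
  open Algebra.Properties.Group +-group using (x≈y⇒x∙y⁻¹≈ε; x∙y⁻¹≈ε⇒x≈y)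
  open Relation.Binary.Reasoning.Setoid setoid

  private
    domain = proj₁ dedekind
    noetherian = proj₁ (proj₂ dedekind)
    integrallyClosed = proj₁ (proj₂ (proj₂ dedekind))
    nonzeroPrime⇒maximal = proj₂ (proj₂ (proj₂ dedekind))

  open Classical R (proj₁ domain) noetherian

  *-cancelˡ : ∀ {z x y} → ¬ z ≈ 0# → z * x ≈ z * y → x ≈ y
  *-cancelˡ {z} {x} {y} z≉0 e with proj₂ domain z (x - y)
    (≈-trans (solve 3 (λ z x y → z :* (x :- y) := z :* x :- z :* y) ≈-refl z x y) (x≈y⇒x∙y⁻¹≈ε e))
  ... | inj₁ z≈0 = contradiction z≈0 z≉0
  ... | inj₂ d   = x∙y⁻¹≈ε⇒x≈y _ _ d

  -- An element u = b/a of the fraction field with uP ⊆ P is integral over R: for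
  -- 0 ≠ x ∈ P the chain of ideals (x, ux, …, uⁿx) of R stabilises.
  module _ (P : Ideal R) {a b : Carrier} (a≉0 : ¬ a ≈ 0#)
    (mult : ∀ x → mem P x → ∃[ y ] (mem P y × b * x ≈ a * y)) where

    private
      -- Multiplication by u = b/a; the membership proof is carried along so that the map can be
      -- iterated.
      u· : ∃ (mem P) → ∃ (mem P)
      u· (x , m) = proj₁ (mult x m) , proj₁ (proj₂ (mult x m))

      u·-eq : ∀ x → a * proj₁ (u· x) ≈ b * proj₁ x
      u·-eq (x , m) = ≈-sym (proj₂ (proj₂ (mult x m)))

      u^ : ℕ → ∃ (mem P) → Carrier
      u^ zero    x = proj₁ x
      u^ (suc n) x = u^ n (u· x)

      u^-eq : ∀ n x → powR R a n * u^ n x ≈ powR R b n * proj₁ x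
      u^-eq zero    x = ≈-refl
      u^-eq (suc n) x = begin
        a * aⁿ * u^ n (u· x)           ≈⟨ *-assoc a aⁿ _ ⟩
        a * (aⁿ * u^ n (u· x))         ≈⟨ *-congˡ (u^-eq n (u· x)) ⟩
        a * (bⁿ * proj₁ (u· x))        ≈⟨ solve 3 (λ a b x → a :* (b :* x) := b :* (a :* x)) ≈-refl a bⁿ _ ⟩
        bⁿ * (a * proj₁ (u· x))        ≈⟨ *-congˡ (u·-eq x) ⟩
        bⁿ * (b * proj₁ x)             ≈⟨ solve 3 (λ c b x → c :* (b :* x) := b :* c :* x) ≈-refl bⁿ b _ ⟩
        b * bⁿ * proj₁ x               ∎
        where
        aⁿ = powR R a n
        bⁿ = powR R b n

      span : ℕ → ∃ (mem P) → Ideal R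
      span zero    x = principal (proj₁ x)
      span (suc n) x = principal (proj₁ x) ⊹ span n (u· x)

      span-mono : ∀ n x {y} → mem (span n x) y → mem (span (suc n) x) y
      span-mono zero    x {y} m = y , 0# , m , 0∈ (principal _) , ≈-sym (+-identityʳ y)
      span-mono (suc n) x (y , z , m , m′ , e) = y , z , m , span-mono n (u· x) m′ , e

      u^∈span : ∀ n x → mem (span n x) (u^ n x)
      u^∈span zero    x = lift (1# , ≈-sym (*-identityˡ _))
      u^∈span (suc n) x = 0# , _ , 0∈ (principal _) , u^∈span n (u· x) , ≈-sym (+-identityˡ _)

      -- If y = r₀x + r₁ux + ... + rₙuⁿx, the rᵢ are the lower coefficients of a monic f of degree
      -- n+1, and the equation is aⁿ⁺¹f(u)x = bⁿ⁺¹x + aⁿ⁺¹y.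
      relation : ∀ n x {y} → mem (span n x) y → ∃[ ks ] (length ks ≡ suc n ×
        proj₁ x * homogMonic R b a ks ≈ proj₁ x * powR R b (suc n) + powR R a (suc n) * y)
      relation zero    (x , _) {y} (lift (r , e)) = r ∷ [] , refl , (begin
        x * (r * (a * 1#) + b * 1#)
          ≈⟨ solve 4 (λ x r a b → x :* (r :* (a :* :1) :+ b :* :1) := x :* (b :* :1) :+ a :* :1 :* (r :* x)) ≈-refl x r a b ⟩
        x * (b * 1#) + a * 1# * (r * x)
          ≈⟨ +-congˡ (*-congˡ e) ⟨
        x * (b * 1#) + a * 1# * y ∎)
      relation (suc n) x̂@(x , _) {y} (z , w , lift (r , z≈rx) , m , e) with relation n (u· x̂) m
      ... | ks , len , eq = r ∷ ks , cong suc len , (begin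
        x * (r * (a * powR R a (length ks)) + b * H)
          ≡⟨ cong (λ k → x * (r * (a * powR R a k) + b * H)) len ⟩
        x * (r * (a * A) + b * H)
          ≈⟨ solve 6 (λ x r a A b H → x :* (r :* (a :* A) :+ b :* H) := x :* (r :* (a :* A)) :+ (b :* x) :* H) ≈-refl x r a A b H ⟩
        x * (r * (a * A)) + b * x * H
          ≈⟨ +-congˡ (*-congʳ (u·-eq x̂)) ⟨
        x * (r * (a * A)) + a * x′ * H
          ≈⟨ +-congˡ (≈-trans (*-assoc a x′ H) (*-congˡ eq)) ⟩
        x * (r * (a * A)) + a * (x′ * B + A * w)
          ≈⟨ solve 7 (λ x r a A x′ B w → x :* (r :* (a :* A)) :+ a :* (x′ :* B :+ A :* w)
               := a :* x′ :* B :+ a :* A :* (r :* x :+ w)) ≈-refl x r a A x′ B w ⟩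
        a * x′ * B + a * A * (r * x + w)
          ≈⟨ +-cong (*-congʳ (u·-eq x̂)) (*-congˡ (≈-sym (≈-trans e (+-congʳ z≈rx)))) ⟩
        b * x * B + a * A * y
          ≈⟨ +-congʳ (solve 3 (λ b x B → b :* x :* B := x :* (b :* B)) ≈-refl b x B) ⟩
        x * (b * B) + a * A * y ∎)
        where
        x′ = proj₁ (u· x̂)
        A  = powR R a (suc n)
        B  = powR R b (suc n)
        H  = homogMonic R b a ks

    stable⇒divides : Nonzero R P → ∃[ q ] b ≈ q * a
    stable⇒divides (x , x∈P , x≉0)
      with stabilises (λ n → span n (x , x∈P)) (λ n → span-mono n (x , x∈P))
    -- Stability puts uⁿ⁺¹x into the span of the lower uⁱx; with y = -uⁿ⁺¹x the right side of
    -- `relation` vanishes.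
    ... | n , stop with relation n (x , x∈P) (-∈ (span n (x , x∈P)) (stop (u^∈span (suc n) (x , x∈P))))
    ...   | ks , _ , eq = integrallyClosed b a a≉0 (ks , *-cancelˡ x≉0 (begin
      x * homogMonic R b a ks         ≈⟨ eq ⟩
      x * B + A * - e                 ≈⟨ solve 4 (λ x B A e → x :* B :+ A :* :- e := x :* B :- A :* e) ≈-refl x B A e ⟩
      x * B - A * e                   ≈⟨ +-congˡ (-‿cong (u^-eq (suc n) (x , x∈P))) ⟩
      x * B - B * x                   ≈⟨ solve 2 (λ x B → x :* B :- B :* x := x :* :0) ≈-refl x B ⟩
      x * 0#                          ∎))
      where
      A = powR R a (suc n)
      B = powR R b (suc n)
      e = u^ (suc n) (x , x∈P)

  module _ (P : Ideal R) (isPrime : IsPrime R P) (P≢0 : Nonzero R P) where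

    private
      a = proj₁ P≢0
      a∈P = proj₁ (proj₂ P≢0)
      a≉0 = proj₂ (proj₂ P≢0)

    prime-*∉ : ∀ {x y} → ¬ mem P x → ¬ mem P y → ¬ mem P (x * y)
    prime-*∉ x∉ y∉ m = [ x∉ , y∉ ]′ (proj₂ isPrime _ _ m)

    isMaximal : IsMaximal R P
    isMaximal = nonzeroPrime⇒maximal P isPrime P≢0

    -- The ideal (aR_P : x) ∩ R.
    colon : Carrier → Ideal R
    colon x .mem r = ∃[ s ] (¬ mem P s × ∃[ w ] s * (r * x) ≈ w * a)
    colon x .resp r≈r′ (s , s∉ , w , e) = s , s∉ , w , ≈-trans (*-congˡ (*-congʳ (≈-sym r≈r′))) e
    colon x .0∈ = 1# , proj₁ isPrime , 0# , solve 2 (λ x a → :1 :* (:0 :* x) := :0 :* a) ≈-refl x a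
    colon x .+∈ {r} {r′} (s , s∉ , w , e) (s′ , s′∉ , w′ , e′) =
      s * s′ , prime-*∉ s∉ s′∉ , s′ * w + s * w′ , (begin
        s * s′ * ((r + r′) * x)
          ≈⟨ solve 5 (λ s s′ r r′ x → s :* s′ :* ((r :+ r′) :* x) := s′ :* (s :* (r :* x)) :+ s :* (s′ :* (r′ :* x))) ≈-refl s s′ r r′ x ⟩
        s′ * (s * (r * x)) + s * (s′ * (r′ * x))
          ≈⟨ +-cong (*-congˡ e) (*-congˡ e′) ⟩
        s′ * (w * a) + s * (w′ * a)
          ≈⟨ solve 5 (λ s s′ w w′ a → s′ :* (w :* a) :+ s :* (w′ :* a) := (s′ :* w :+ s :* w′) :* a) ≈-refl s s′ w w′ a ⟩
        (s′ * w + s * w′) * a ∎)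
    colon x .*∈ t {r} (s , s∉ , w , e) = s , s∉ , t * w , (begin
      s * (t * r * x)   ≈⟨ solve 4 (λ s t r x → s :* (t :* r :* x) := t :* (s :* (r :* x))) ≈-refl s t r x ⟩
      t * (s * (r * x)) ≈⟨ *-congˡ e ⟩
      t * (w * a)       ≈⟨ *-assoc t w a ⟨
      t * w * a         ∎)

    -- With its converse below: (aR_P : xy) is the colon of (aR_P : y) by x, so multiplying the
    -- element enlarges the colon ideal.
    colon-* : ∀ x y {r} → mem (colon (x * y)) r → mem (colon y) (r * x)
    colon-* x y {r} (s , s∉ , w , e) = s , s∉ , w , ≈-trans (*-congˡ (*-assoc r x y)) e

    colon-*⁻ : ∀ x y {r} → mem (colon y) (r * x) → mem (colon (x * y)) r
    colon-*⁻ x y {r} (s , s∉ , w , e) = s , s∉ , w , ≈-trans (*-congˡ (≈-sym (*-assoc r x y))) e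

    private
      -- The elements outside aR_P, encoded by properness since 1 ∈ (aR_P : x) means x ∈ aR_P.
      ∉aR : Set (c ⊔ ℓ)
      ∉aR = ∃[ x ] Proper R (colon x)

      Larger : ∉aR → Set (c ⊔ ℓ)
      Larger (x , _) = Σ ∉aR λ (y , _) → (∀ {r} → mem (colon x) r → mem (colon y) r) ×
        ∃[ r ] (mem (colon y) r × ¬ mem (colon x) r)

      -- If rr′ lies in (aR_P : x) but neither factor does, then (aR_P : rx) is proper because r is
      -- outside, and it gains r′.
      enlarge : (x : ∉aR) → ¬ IsPrime R (colon (proj₁ x)) → Larger x
      enlarge (x , proper) ¬prime with lem (∃[ r ] ∃[ r′ ] (mem (colon x) (r * r′) × ¬ mem (colon x) r × ¬ mem (colon x) r′))
      ... | yes (r , r′ , rr′∈ , r∉ , r′∉) =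
        (r * x , λ m → r∉ (resp (colon x) (*-identityˡ r) (colon-* r x m))) ,
        (λ m → colon-*⁻ r x (*∈ʳ (colon x) r m)) ,
        r′ , colon-*⁻ r x (resp (colon x) (*-comm r r′) rr′∈) , r′∉
      ... | no ∄ = contradiction (proper , λ r r′ rr′∈ → dec r r′ rr′∈ (lem (mem (colon x) r)) (lem (mem (colon x) r′))) ¬prime
        where
        dec : ∀ r r′ → mem (colon x) (r * r′) → Dec (mem (colon x) r) → Dec (mem (colon x) r′) →
          mem (colon x) r ⊎ mem (colon x) r′
        dec r r′ rr′∈ (yes m) _        = inj₁ m
        dec r r′ rr′∈ (no _)  (yes m′) = inj₂ m′
        dec r r′ rr′∈ (no ∉)  (no ∉′)  = contradiction (r , r′ , rr′∈ , ∉ , ∉′) ∄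

    -- A nonprime (aR_P : x) ∩ R is properly contained in another one; ascending chains stop.
    ∃-prime-colon : ∃[ x ] IsPrime R (colon x)
    ∃-prime-colon = by-contradiction λ ∄ → absurd (λ x → enlarge x (λ p → ∄ (proj₁ x , p)))
      where
      absurd : ¬ ((x : ∉aR) → Larger x)
      absurd larger = refute (stabilises (λ n → colon (proj₁ (seq n))) (λ n → proj₁ (proj₂ (larger (seq n)))))
        where
        -- The chain can start at x = 1: an equation s = wa with a ∈ `P` would put s into `P`.
        1∉ : Proper R (colon 1#)
        1∉ (s , s∉ , w , e) = s∉ (resp P (≈-sym (≈-trans (solve 1 (λ s → s := s :* (:1 :* :1)) ≈-refl s) e)) (*∈ P w a∈P))
        seq : ℕ → ∉aR
        seq zero    = 1# , 1∉
        seq (suc n) = proj₁ (larger (seq n))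
        refute : ¬ (∃[ n ] (∀ {r} → mem (colon (proj₁ (seq (suc n)))) r → mem (colon (proj₁ (seq n))) r))
        refute (n , stop) = let (_ , r∈ , r∉) = proj₂ (proj₂ (larger (seq n))) in r∉ (stop r∈)

    -- An element t outside `P` could be absorbed into the denominator, giving 1 ∈ (aR_P : x); so
    -- this ideal lies in `P`. Being prime and containing a ≠ 0, it is maximal, hence equal to `P`.
    prime-colon⊇ : ∀ x → IsPrime R (colon x) → ∀ {r} → mem P r → mem (colon x) r
    prime-colon⊇ x colonPrime {r} r∈P
      with nonzeroPrime⇒maximal (colon x) colonPrime
        (a , (1# , proj₁ isPrime , x , solve 2 (λ a x → :1 :* (a :* x) := x :* a) ≈-refl a x) , a≉0)
    ... | _ , max with max P colon⊆P
      where
      colon⊆P : ∀ t → mem (colon x) t → mem P t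
      colon⊆P t (s , s∉ , w , e) = by-contradiction λ t∉ → proj₁ colonPrime
        (s * t , prime-*∉ s∉ t∉ , w , ≈-trans (solve 3 (λ s t x → s :* t :* (:1 :* x) := s :* (t :* x)) ≈-refl s t x) e)
    ...   | inj₁ P⊆  = P⊆ r r∈P
    ...   | inj₂ 1∈P = contradiction 1∈P (proj₁ isPrime)

    -- The product of the finitely many denominators serves all elements of the list.
    common-denominator : ∀ x {gs} → All (mem (colon x)) gs →
      ∃[ s ] (¬ mem P s × All (λ r → mem (principal a) (r * (s * x))) gs)
    common-denominator x []                        = 1# , proj₁ isPrime , []
    common-denominator x (_∷_ {r} (s , s∉ , w , e) ms) with common-denominator x ms
    ... | s′ , s′∉ , ds = s * s′ , prime-*∉ s∉ s′∉ ,
      lift (s′ * w , (begin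
        r * (s * s′ * x)   ≈⟨ solve 4 (λ r s s′ x → r :* (s :* s′ :* x) := s′ :* (s :* (r :* x))) ≈-refl r s s′ x ⟩
        s′ * (s * (r * x)) ≈⟨ *-congˡ e ⟩
        s′ * (w * a)       ≈⟨ *-assoc s′ w a ⟨
        s′ * w * a         ∎)) ∷
      All.map (λ {r′} d → resp (principal a)
        (solve 4 (λ r s s′ x → s :* (r :* (s′ :* x)) := r :* (s :* s′ :* x)) ≈-refl r′ s s′ x)
        (*∈ (principal a) s d)) ds

    -- In the fraction field, b/a is an element of P⁻¹ outside `R`.
    NearDivisor : Set (c ⊔ ℓ)
    NearDivisor = ∃[ b ] ((∀ {r} → mem P r → mem (principal a) (r * b)) × ¬ mem (principal a) b)

    -- Clearing denominators on generators of `P` turns Px ⊆ aR_P into P(sx) ⊆ aR with s outside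
    -- `P`. If b = sx lay in aR, then 1 would lie in (aR_P : x).
    ∃-nearDivisor : NearDivisor
    ∃-nearDivisor = clear ∃-prime-colon (noetherian P)
      where
      clear : ∃[ x ] IsPrime R (colon x) →
        ∃[ gs ] (_⊆ᵣ_ R (mem P) (Generated R gs) × _⊆ᵣ_ R (Generated R gs) (mem P)) → NearDivisor
      clear (x , colonPrime) (gs , P⊆ , ⊆P)
        with common-denominator x (All.map (prime-colon⊇ x colonPrime) (generators∈ gs ⊆P))
      ... | s , s∉ , ds = s * x ,
        (λ r∈ → generated⊆ transporter ds (P⊆ _ r∈)) ,
        (λ (lift (w , e)) → proj₁ colonPrime (s , s∉ , w , ≈-trans (*-congˡ (*-identityˡ x)) e))
        where
        transporter : Ideal R
        transporter .mem r = mem (principal a) (r * (s * x))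
        transporter .resp r≈r′ = resp (principal a) (*-congʳ r≈r′)
        transporter .0∈ = resp (principal a) (≈-sym (zeroˡ _)) (0∈ (principal a))
        transporter .+∈ m n = resp (principal a) (≈-sym (distribʳ _ _ _)) (+∈ (principal a) m n)
        transporter .*∈ t m = resp (principal a) (≈-sym (*-assoc t _ _)) (*∈ (principal a) t m)

    -- `t` generates PR_P, and one `s`, a unit of R_P, clears the denominators for all of `P`.
    record LocalUniformiser : Set (c ⊔ ℓ) where
      field
        t s   : Carrier
        t∈P   : mem P t
        s∉P   : ¬ mem P s
        t≉0   : ¬ t ≈ 0#
        sP⊆tR : ∀ {p} → mem P p → ∃[ w ] s * p ≈ t * w

    -- With b as in NearDivisor, (b/a)P is an ideal of R; it is not contained in P, for otherwise
    -- b/a would be integral.  So tb = sa for some t ∈ P and s ∉ P.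
    localUniformiser : NearDivisor → LocalUniformiser
    localUniformiser (b , Pb⊆aR , b∉aR) with lem (∃[ r ] ∃[ w ] (mem P r × ¬ mem P w × r * b ≈ w * a))
    ... | no ∄ = contradiction (lift (stable⇒divides P a≉0 stable P≢0)) b∉aR
      where
      stable : ∀ x → mem P x → ∃[ y ] (mem P y × b * x ≈ a * y)
      stable x x∈ with Pb⊆aR x∈
      ... | lift (w , e) = w , by-contradiction (λ w∉ → ∄ (x , w , x∈ , w∉ , e)) ,
        ≈-trans (*-comm b x) (≈-trans e (*-comm w a))
    ... | yes (t , s , t∈ , s∉ , tb≈sa) = record
      { t = t ; s = s ; t∈P = t∈ ; s∉P = s∉
      ; t≉0 = λ t≈0 → [ (λ s≈0 → s∉ (resp P (≈-sym s≈0) (0∈ P))) , a≉0 ]′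
          (proj₂ domain s a (≈-trans (≈-sym tb≈sa) (≈-trans (*-congʳ t≈0) (zeroˡ b))))
      ; sP⊆tR = sP⊆tR }
      where
      sP⊆tR : ∀ {p} → mem P p → ∃[ w ] s * p ≈ t * w
      sP⊆tR {p} p∈ with Pb⊆aR p∈
      ... | lift (w , e) = w , *-cancelˡ a≉0 (begin
        a * (s * p) ≈⟨ solve 3 (λ a s p → a :* (s :* p) := p :* (s :* a)) ≈-refl a s p ⟩
        p * (s * a) ≈⟨ *-congˡ tb≈sa ⟨
        p * (t * b) ≈⟨ solve 3 (λ p t b → p :* (t :* b) := t :* (p :* b)) ≈-refl p t b ⟩
        t * (p * b) ≈⟨ *-congˡ e ⟩
        t * (w * a) ≈⟨ solve 3 (λ t w a → t :* (w :* a) := a :* (t :* w)) ≈-refl t w a ⟩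
        a * (t * w) ∎)

    -- Powers of `P` in terms of a local uniformiser.

    module PowerLemmas (uniformiser : LocalUniformiser) where
      open LocalUniformiser uniformiser

      -- The colon ideal (zR : x).
      multiples : Carrier → Carrier → Ideal R
      multiples x z .mem y = Lift (c ⊔ ℓ) (∃[ w ] x * y ≈ z * w)
      multiples x z .resp y≈y′ (lift (w , e)) = lift (w , ≈-trans (*-congˡ (≈-sym y≈y′)) e)
      multiples x z .0∈ = lift (0# , ≈-trans (zeroʳ x) (≈-sym (zeroʳ z)))
      multiples x z .+∈ (lift (w , e)) (lift (w′ , e′)) =
        lift (w + w′ , ≈-trans (distribˡ x _ _) (≈-trans (+-cong e e′) (≈-sym (distribˡ z w w′))))
      multiples x z .*∈ r {y} (lift (w , e)) = lift (r * w , (begin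
        x * (r * y) ≈⟨ solve 3 (λ x r y → x :* (r :* y) := r :* (x :* y)) ≈-refl x r y ⟩
        r * (x * y) ≈⟨ *-congˡ e ⟩
        r * (z * w) ≈⟨ solve 3 (λ z r w → r :* (z :* w) := z :* (r :* w)) ≈-refl z r w ⟩
        z * (r * w) ∎))

      t^∈P^ : ∀ i → mem (P ^ᴵ i) (powR R t i)
      t^∈P^ zero    = lift tt
      t^∈P^ (suc i) = ·-intro P (P ^ᴵ i) t∈P (t^∈P^ i)

      t^≉0 : ∀ i → ¬ powR R t i ≈ 0#
      t^≉0 zero    e = proj₁ domain e
      t^≉0 (suc i) e = [ t≉0 , t^≉0 i ]′ (proj₂ domain _ _ e)

      -- Since `multiples` is an ideal, only products of an element of `P` with one of Pⁱ need
      -- checking.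
      s^P^⊆t^R : ∀ i {y} → mem (P ^ᴵ i) y → mem (multiples (powR R s i) (powR R t i)) y
      s^P^⊆t^R zero    {y} _ = lift (y , ≈-refl)
      s^P^⊆t^R (suc i) = ·-elim P (P ^ᴵ i) (multiples (powR R s (suc i)) (powR R t (suc i)))
        λ p y p∈ y∈ → let (w , e) = sP⊆tR p∈ ; lift (w′ , e′) = s^P^⊆t^R i y∈ in lift (w * w′ , (begin
          s * sⁱ i * (p * y)   ≈⟨ solve 4 (λ s sⁱ p y → s :* sⁱ :* (p :* y) := s :* p :* (sⁱ :* y)) ≈-refl s (sⁱ i) p y ⟩
          s * p * (sⁱ i * y)   ≈⟨ *-cong e e′ ⟩
          t * w * (tⁱ i * w′)  ≈⟨ solve 4 (λ t w tⁱ w′ → t :* w :* (tⁱ :* w′) := t :* tⁱ :* (w :* w′)) ≈-refl t w (tⁱ i) w′ ⟩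
          t * tⁱ i * (w * w′)  ∎))
        where
        sⁱ = powR R s
        tⁱ = powR R t

      -- Multiply by sⁱ⁺¹ and cancel tⁱ: sⁱ⁺¹x = tw lies in `P`, but sⁱ⁺¹ does not. This gives
      -- uniqueness of the digit b modulo `P`.
      t^*∈⇒∈ : ∀ i {x} → mem (P ^ᴵ suc i) (powR R t i * x) → mem P x
      t^*∈⇒∈ i {x} m with s^P^⊆t^R (suc i) m
      ... | lift (w , e) = [ (λ s∈ → contradiction s∈ (prime-pow∉ P isPrime (suc i) s∉P)) , id ]′
        (proj₂ isPrime _ _ (resp P (≈-sym (*-cancelˡ (t^≉0 i) (begin
          tⁱ * (s * sⁱ * x) ≈⟨ solve 3 (λ tⁱ z x → tⁱ :* (z :* x) := z :* (tⁱ :* x)) ≈-refl tⁱ (s * sⁱ) x ⟩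
          s * sⁱ * (tⁱ * x) ≈⟨ e ⟩
          t * tⁱ * w        ≈⟨ solve 3 (λ t tⁱ w → t :* tⁱ :* w := tⁱ :* (t :* w)) ≈-refl t tⁱ w ⟩
          tⁱ * (t * w)      ∎))) (*∈ʳ P w t∈P)))
        where
        tⁱ = powR R t i
        sⁱ = powR R s i

      -- Let u invert sⁱ modulo `P`. Then (1 - sⁱu)y lies in P · Pⁱ, and sⁱy = tⁱw. This gives
      -- existence of the digit.
      ∈P^⇒t^* : ∀ i {y} → mem (P ^ᴵ i) y → ∃[ r ] y ≡ powR R t i * r [mod P ^ᴵ suc i ]
      ∈P^⇒t^* i {y} y∈ with s^P^⊆t^R i y∈ | maximal⇒unitMod P isMaximal (prime-pow∉ P isPrime i s∉P)
      ... | lift (w , e) | u , su≡1 = w * u , resp (P ^ᴵ suc i) (begin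
          - (sⁱ * u - 1#) * y   ≈⟨ solve 3 (λ sⁱ u y → :- (sⁱ :* u :- :1) :* y := y :- sⁱ :* y :* u) ≈-refl sⁱ u y ⟩
          y - sⁱ * y * u        ≈⟨ +-congˡ (-‿cong (≈-trans (*-congʳ e) (*-assoc tⁱ w u))) ⟩
          y - tⁱ * (w * u)      ∎)
        (·-intro P (P ^ᴵ i) (-∈ P su≡1) y∈)
        where
        tⁱ = powR R t i
        sⁱ = powR R s i

-- Complete residue systems and sums over them.

module ResidueSystems {c ℓ} (R : CommutativeRing c ℓ) (dedekind : IsDedekindDomain R) where
  open CommutativeRing R hiding (zero)
    renaming (refl to ≈-refl; sym to ≈-sym; trans to ≈-trans)
  open IntegerCoefficients R using (solve; _:=_; _:+_; _:*_; _:-_)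
  open IdealLemmas R
  open Uniformiser R dedekind
  open Classical R (proj₁ (proj₁ dedekind)) (proj₁ (proj₂ dedekind)) using (lem)

  ⟦_≡_mod_⟧ : Carrier → Carrier → Ideal R → ℕ
  ⟦ x ≡ y mod J ⟧ = ind (lem (x ≡ y [mod J ]))

  Complete : Ideal R → List Carrier → Set c
  Complete J L = ∀ x → ∑ L (λ y → ⟦ x ≡ y mod J ⟧) ≡ 1

  complete-resp : ∀ {A B : Ideal R} → (∀ {x} → mem A x → mem B x) → (∀ {x} → mem B x → mem A x) →
    ∀ L → Complete A L → Complete B L
  complete-resp A⊆B B⊆A L h x = ≡.trans (∑-cong L λ y → ind-cong (lem _) (lem _) B⊆A A⊆B) (h x)

  complete-whole : Complete whole (0# ∷ [])
  complete-whole x = cong (ℕ._+ 0) (ind-yes (lem (x ≡ 0# [mod whole ])) (lift tt))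

  complete-quotient : ∀ {J} (Q : FiniteQuotient R J) → Complete J (map (rep Q) (allFin (size Q)))
  complete-quotient {J} Q x = begin
    ∑ (map (rep Q) (allFin n)) (λ y → ⟦ x ≡ y mod J ⟧) ≡⟨ ∑-map (rep Q) (allFin n) _ ⟩
    ∑ (allFin n) (λ j → ⟦ x ≡ rep Q j mod J ⟧)
      ≡⟨ ∑-cong (allFin n) (λ j → ind-cong (lem _) (π Q x Finₚ.≟ j)
          (λ m → ≡.trans (ker⇐ Q x (rep Q j) m) (proj₂ (surj Q j)))
          (λ e → ker⇒ Q x (rep Q j) (≡.trans e (≡.sym (proj₂ (surj Q j)))))) ⟩
    ∑ (allFin n) (λ j → ind (π Q x Finₚ.≟ j))           ≡⟨ ∑-allFin-≟ (π Q x) ⟩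
    1                                                  ∎
    where
    open ≡.≡-Reasoning
    n = size Q

  Periodic : Ideal R → (Carrier → ℕ) → Set (c ⊔ ℓ)
  Periodic J f = ∀ {x y} → x ≡ y [mod J ] → f x ≡ f y

  -- Insert 1 = ∑_{y ∈ L′} [x ≡ y], exchange the sums and replace f x by f y where x ≡ y; the inner
  -- sum over `L` is then 1.
  ∑-complete-unique : ∀ J {f} → Periodic J f → ∀ L L′ → Complete J L → Complete J L′ → ∑ L f ≡ ∑ L′ f
  ∑-complete-unique J {f} periodic L L′ h h′ = begin
    ∑ L f                                                     ≡⟨ ∑-cong L (λ x → ℕₚ.*-identityˡ (f x)) ⟨
    ∑ L (λ x → 1 ℕ.* f x)                                     ≡⟨ ∑-cong L (λ x → cong (ℕ._* f x) (h′ x)) ⟨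
    ∑ L (λ x → ∑ L′ (λ y → ⟦ x ≡ y mod J ⟧) ℕ.* f x)          ≡⟨ ∑-cong L (λ x → ∑-*ʳ L′ (f x) _) ⟨
    ∑ L (λ x → ∑ L′ (λ y → ⟦ x ≡ y mod J ⟧ ℕ.* f x))          ≡⟨ ∑-swap L L′ _ ⟩
    ∑ L′ (λ y → ∑ L (λ x → ⟦ x ≡ y mod J ⟧ ℕ.* f x))          ≡⟨ ∑-cong L′ (λ y → ∑-cong L (λ x → exchange x y)) ⟩
    ∑ L′ (λ y → ∑ L (λ x → ⟦ y ≡ x mod J ⟧ ℕ.* f y))          ≡⟨ ∑-cong L′ (λ y → ∑-*ʳ L (f y) _) ⟩
    ∑ L′ (λ y → ∑ L (λ x → ⟦ y ≡ x mod J ⟧) ℕ.* f y)          ≡⟨ ∑-cong L′ (λ y → cong (ℕ._* f y) (h y)) ⟩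
    ∑ L′ (λ y → 1 ℕ.* f y)                                    ≡⟨ ∑-cong L′ (λ y → ℕₚ.*-identityˡ (f y)) ⟩
    ∑ L′ f                                                    ∎
    where
    open ≡.≡-Reasoning
    exchange : ∀ x y → ⟦ x ≡ y mod J ⟧ ℕ.* f x ≡ ⟦ y ≡ x mod J ⟧ ℕ.* f y
    exchange x y with lem (x ≡ y [mod J ]) | lem (y ≡ x [mod J ])
    ... | yes m | yes _ = cong (1 ℕ.*_) (periodic m)
    ... | yes m | no ¬m = contradiction (mod-sym J m) ¬m
    ... | no ¬m | yes m = contradiction (mod-sym J m) ¬m
    ... | no _  | no _  = refl

  -- The Chinese remainder theorem.

  module ChineseRemainder (A B : Ideal R) (comaximal : Comaximal A B) where
    private
      e  = proj₁ comaximal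
      e′ = proj₁ (proj₂ comaximal)
      e∈A  = proj₁ (proj₂ (proj₂ comaximal))
      e′∈B = proj₁ (proj₂ (proj₂ (proj₂ comaximal)))
      1≈e+e′ = proj₂ (proj₂ (proj₂ (proj₂ comaximal)))

    -- From 1 = e + e′ with e ∈ `A` and e′ ∈ `B`: e′ is 1 modulo `A` and 0 modulo `B`, and e the
    -- reverse.
    glue : Carrier → Carrier → Carrier
    glue a b = e′ * a + e * b

    glue≡ˡ : ∀ a b → glue a b ≡ a [mod A ]
    glue≡ˡ a b = resp A (≈-trans
      (solve 4 (λ e e′ a b → e :* (b :- a) := e′ :* a :+ e :* b :- (e :+ e′) :* a) ≈-refl e e′ a b)
      (+-congˡ (-‿cong (≈-trans (*-congʳ (≈-sym 1≈e+e′)) (*-identityˡ a))))) (*∈ʳ A (b - a) e∈A)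

    glue≡ʳ : ∀ a b → glue a b ≡ b [mod B ]
    glue≡ʳ a b = resp B (≈-trans
      (solve 4 (λ e e′ a b → e′ :* (a :- b) := e′ :* a :+ e :* b :- (e :+ e′) :* b) ≈-refl e e′ a b)
      (+-congˡ (-‿cong (≈-trans (*-congʳ (≈-sym 1≈e+e′)) (*-identityˡ b))))) (*∈ʳ B (a - b) e′∈B)

    -- Write x = ex + xe′; each term is a product of an element of `A` with one of `B`.
    ∩⊆· : ∀ {x} → mem A x → mem B x → mem (A · B) x
    ∩⊆· {x} x∈A x∈B = resp (A · B)
      (≈-trans (solve 3 (λ e e′ x → e :* x :+ x :* e′ := (e :+ e′) :* x) ≈-refl e e′ x)
        (≈-trans (*-congʳ (≈-sym 1≈e+e′)) (*-identityˡ x)))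
      (+∈ (A · B) (·-intro A B e∈A x∈B) (·-intro A B x∈A e′∈B))

    ∑-glue : ∀ L L′ (f g h : Carrier → ℕ) → (∀ a b → f (glue a b) ≡ g a ℕ.* h b) →
      ∑ (cartesianProductWith glue L L′) f ≡ ∑ L g ℕ.* ∑ L′ h
    ∑-glue L L′ f g h eq = begin
      ∑ (cartesianProductWith glue L L′) f    ≡⟨ ∑-cartesianProductWith glue L L′ f ⟩
      ∑ L (λ a → ∑ L′ (λ b → f (glue a b)))   ≡⟨ ∑-cong L (λ a → ∑-cong L′ (eq a)) ⟩
      ∑ L (λ a → ∑ L′ (λ b → g a ℕ.* h b))    ≡⟨ ∑-cong L (λ a → ∑-*ˡ L′ (g a) h) ⟩
      ∑ L (λ a → g a ℕ.* ∑ L′ h)              ≡⟨ ∑-*ʳ L (∑ L′ h) g ⟩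
      ∑ L g ℕ.* ∑ L′ h                        ∎
      where open ≡.≡-Reasoning

    complete-glue : ∀ L L′ → Complete A L → Complete B L′ → Complete (A · B) (cartesianProductWith glue L L′)
    complete-glue L L′ hA hB x = ≡.trans
      (∑-glue L L′ _ (λ a → ⟦ x ≡ a mod A ⟧) (λ b → ⟦ x ≡ b mod B ⟧) λ a b →
        ind-× (lem (x ≡ a [mod A ])) (lem (x ≡ b [mod B ])) (lem (x ≡ glue a b [mod A · B ]))
          (λ m → mod-trans A (·⊆ˡ A B m) (glue≡ˡ a b) , mod-trans B (·⊆ʳ A B m) (glue≡ʳ a b))
          (λ m n → ∩⊆· (mod-trans A m (mod-sym A (glue≡ˡ a b))) (mod-trans B n (mod-sym B (glue≡ʳ a b)))))
      (cong₂ ℕ._*_ (hA x) (hB x))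

  -- Common neighbours of a clique.

  -- v is a common neighbour of us in the unitary Cayley graph of R/J.
  AllUnits : Ideal R → List Carrier → Carrier → Set (c ⊔ ℓ)
  AllUnits J us v = All (λ u → UnitMod J (v - u)) us

  PairwiseUnits : Ideal R → List Carrier → Set (c ⊔ ℓ)
  PairwiseUnits J = AllPairs (λ u v → UnitMod J (u - v))

  neighbours : Ideal R → List Carrier → Carrier → ℕ
  neighbours J us v = ind (lem (AllUnits J us v))

  allUnits-resp : ∀ J us {x y} → x ≡ y [mod J ] → AllUnits J us x → AllUnits J us y
  allUnits-resp J us {x} {y} x≡y = All.map λ {u} → unitMod-resp J
    (resp J (solve 3 (λ x y u → x :- y := (x :- u) :- (y :- u)) ≈-refl x y u) x≡y)

  neighbours-periodic : ∀ J us → Periodic J (neighbours J us)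
  neighbours-periodic J us x≡y = ind-cong (lem _) (lem _) (allUnits-resp J us x≡y) (allUnits-resp J us (mod-sym J x≡y))

  -- A unit modulo `A · B` is a unit modulo both factors, and there `glue a b` may be replaced by
  -- `a` and by `b`; so the indicator factors.
  ∑-neighbours-glue : ∀ A B (comaximal : Comaximal A B) us L L′ →
    ∑ (cartesianProductWith (ChineseRemainder.glue A B comaximal) L L′) (neighbours (A · B) us) ≡
    ∑ L (neighbours A us) ℕ.* ∑ L′ (neighbours B us)
  ∑-neighbours-glue A B comaximal us L L′ = ∑-glue L L′ _ _ _ λ a b →
    ind-× (lem (AllUnits A us a)) (lem (AllUnits B us b)) (lem (AllUnits (A · B) us (glue a b)))
      (λ m → allUnits-resp A us (glue≡ˡ a b) (All.map (unitMod-⊆ {A · B} {A} (·⊆ˡ A B)) m) ,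
             allUnits-resp B us (glue≡ʳ a b) (All.map (unitMod-⊆ {A · B} {B} (·⊆ʳ A B)) m))
      (λ m n → All.zipWith (λ (h , k) → unitMod-· A B h k)
        (allUnits-resp A us (mod-sym A (glue≡ˡ a b)) m , allUnits-resp B us (mod-sym B (glue≡ʳ a b)) n))
    where open ChineseRemainder A B comaximal

  -- Each v either differs from all the uᵢ by units or is congruent to exactly one uᵢ.
  neighbours+∑≡1 : ∀ P → IsMaximal R P → ∀ us → PairwiseUnits P us → ∀ v →
    neighbours P us v ℕ.+ ∑ us (λ u → ⟦ u ≡ v mod P ⟧) ≡ 1
  neighbours+∑≡1 P maximal []       []             v = cong (ℕ._+ 0) (ind-yes (lem (AllUnits P [] v)) [])
  neighbours+∑≡1 P maximal (u ∷ us) (u-us ∷ pairs) v with lem (u ≡ v [mod P ])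
  -- Here u contributes the 1; another w ≡ v would put the unit u - w into `P`.
  ... | yes u≡v = cong₂ (λ m n → m ℕ.+ suc n)
      (ind-no (lem (AllUnits P (u ∷ us) v)) λ { (v-u ∷ _) → unitMod⇒∉ P (proj₁ maximal) v-u (mod-sym P u≡v) })
      (≡.trans (∑-cong-All u-us λ {w} u-w → ind-no (lem (w ≡ v [mod P ])) λ w≡v →
          unitMod⇒∉ P (proj₁ maximal) u-w (mod-trans P u≡v (mod-sym P w≡v)))
        (∑-zero us))
  ... | no  u≢v = ≡.trans
      (cong (ℕ._+ ∑ us (λ u → ⟦ u ≡ v mod P ⟧)) (ind-cong (lem (AllUnits P (u ∷ us) v)) (lem (AllUnits P us v))
        All.tail (maximal⇒unitMod P maximal (u≢v ∘ mod-sym P) ∷_)))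
      (neighbours+∑≡1 P maximal us pairs v)

  -- Sum `neighbours+∑≡1` over v in `L`: by completeness each u accounts for exactly one v. The
  -- identity is first proved additively, so `∸` is exact.
  ∑-neighbours-maximal : ∀ P → IsMaximal R P → ∀ us → PairwiseUnits P us → ∀ L → Complete P L →
    ∑ L (neighbours P us) ≡ length L ∸ length us
  ∑-neighbours-maximal P maximal us pairs L h = begin
    N                                       ≡⟨ ℕₚ.m+n∸n≡m N (length us) ⟨
    (N ℕ.+ length us) ∸ length us           ≡⟨ cong (_∸ length us) total ⟩
    length L ∸ length us                    ∎
    where
    open ≡.≡-Reasoning
    N = ∑ L (neighbours P us)
    total : N ℕ.+ length us ≡ length L
    total = begin
      N ℕ.+ length us                                            ≡⟨ cong (N ℕ.+_) (∑-one us) ⟨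
      N ℕ.+ ∑ us (λ _ → 1)                                       ≡⟨ cong (N ℕ.+_) (∑-cong us h) ⟨
      N ℕ.+ ∑ us (λ u → ∑ L (λ v → ⟦ u ≡ v mod P ⟧))             ≡⟨ cong (N ℕ.+_) (∑-swap us L _) ⟩
      N ℕ.+ ∑ L (λ v → ∑ us (λ u → ⟦ u ≡ v mod P ⟧))             ≡⟨ ∑-+ L (neighbours P us) _ ⟨
      ∑ L (λ v → neighbours P us v ℕ.+ ∑ us (λ u → ⟦ u ≡ v mod P ⟧)) ≡⟨ ∑-cong L (neighbours+∑≡1 P maximal us pairs) ⟩
      ∑ L (λ _ → 1)                                              ≡⟨ ∑-one L ⟩
      length L                                                   ∎

  -- Residue systems modulo prime powers.

  -- The representatives of R/Pⁱ⁺¹ above a given a ∈ R/Pⁱ are a + tⁱb with b ∈ R/P.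
  module PrimePowerSystem (P : Ideal R) (isPrime : IsPrime R P) (P≢0 : Nonzero R P)
    (uniformiser : LocalUniformiser P isPrime P≢0) where
    open LocalUniformiser uniformiser using (t; t∈P)
    open PowerLemmas P isPrime P≢0 uniformiser

    module _ (L : List Carrier) (L-complete : Complete P L) where

      -- The index is shifted: `digits i` represents R/Pⁱ⁺¹.
      digits : ℕ → List Carrier
      digits zero    = L
      digits (suc i) = cartesianProductWith (λ a b → a + powR R t (suc i) * b) (digits i) L

      complete-P^1 : Complete (P ^ᴵ 1) L
      complete-P^1 = complete-resp {P} {P ^ᴵ 1}
        (λ {x} m → resp (P ^ᴵ 1) (*-identityʳ x) (·-intro P whole m (lift tt))) (·⊆ˡ P whole) L L-complete

      -- Only those a with x ≡ a modulo Pⁱ can contribute. For these, x - a ≡ tⁱr modulo Pⁱ⁺¹, and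
      -- the condition on b becomes r ≡ b modulo `P`, met exactly once.
      complete-step : ∀ i K → Complete (P ^ᴵ i) K →
        Complete (P ^ᴵ suc i) (cartesianProductWith (λ a b → a + powR R t i * b) K L)
      complete-step i K h x = begin
        ∑ (cartesianProductWith (λ a b → a + tⁱ * b) K L) (λ y → ⟦ x ≡ y mod P ^ᴵ suc i ⟧)
          ≡⟨ ∑-cartesianProductWith _ K L _ ⟩
        ∑ K (λ a → ∑ L (λ b → ⟦ x ≡ a + tⁱ * b mod P ^ᴵ suc i ⟧))
          ≡⟨ ∑-cong K lift-unique ⟩
        ∑ K (λ a → ⟦ x ≡ a mod P ^ᴵ i ⟧)
          ≡⟨ h x ⟩
        1 ∎
        where
        open ≡.≡-Reasoning
        tⁱ = powR R t i
        tⁱ*∈ : ∀ {y} → mem P y → mem (P ^ᴵ suc i) (tⁱ * y)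
        tⁱ*∈ {y} y∈ = resp (P ^ᴵ suc i) (*-comm y tⁱ) (·-intro P (P ^ᴵ i) y∈ (t^∈P^ i))
        lift-unique : ∀ a → ∑ L (λ b → ⟦ x ≡ a + tⁱ * b mod P ^ᴵ suc i ⟧) ≡ ⟦ x ≡ a mod P ^ᴵ i ⟧
        lift-unique a with lem (x ≡ a [mod P ^ᴵ i ])
        ... | no x≢a = ≡.trans (∑-cong L λ b → ind-no (lem _) λ m → x≢a
                (resp (P ^ᴵ i) (solve 4 (λ x a t b → x :- (a :+ t :* b) :+ t :* b := x :- a) ≈-refl x a tⁱ b)
                  (+∈ (P ^ᴵ i) (·⊆ʳ P (P ^ᴵ i) m) (*∈ʳ (P ^ᴵ i) b (t^∈P^ i)))))
              (∑-zero L)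
        ... | yes x≡a = let (r , x-a≡tr) = ∈P^⇒t^* i x≡a in ≡.trans (∑-cong L λ b → ind-cong (lem _) (lem (r ≡ b [mod P ]))
            (λ m → t^*∈⇒∈ i (resp (P ^ᴵ suc i)
              (solve 5 (λ x a t b r → x :- (a :+ t :* b) :- (x :- a :- t :* r) := t :* (r :- b)) ≈-refl x a tⁱ b r)
              (+∈ (P ^ᴵ suc i) m (-∈ (P ^ᴵ suc i) x-a≡tr))))
            (λ m → resp (P ^ᴵ suc i)
              (solve 5 (λ x a t b r → x :- a :- t :* r :+ t :* (r :- b) := x :- (a :+ t :* b)) ≈-refl x a tⁱ b r)
              (+∈ (P ^ᴵ suc i) x-a≡tr (tⁱ*∈ m))))
          (L-complete r)

      complete-digits : ∀ i → Complete (P ^ᴵ suc i) (digits i)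
      complete-digits zero    = complete-P^1
      complete-digits (suc i) = complete-step (suc i) (digits i) (complete-digits i)

      -- Each of the i higher digits is multiplied by a positive power of t ∈ `P`; f does not see
      -- it, and it contributes a factor `length L`.
      ∑-digits : ∀ {f} → Periodic P f → ∀ i → ∑ (digits i) f ≡ length L ^ i ℕ.* ∑ L f
      ∑-digits {f} periodic zero    = ≡.sym (ℕₚ.*-identityˡ _)
      ∑-digits {f} periodic (suc i) = begin
        ∑ (digits (suc i)) f                            ≡⟨ ∑-cartesianProductWith _ (digits i) L f ⟩
        ∑ (digits i) (λ a → ∑ L (λ b → f (a + z * b)))  ≡⟨ ∑-cong (digits i) (λ a → ∑-cong L (λ b → periodic (a+zb≡a a b))) ⟩
        ∑ (digits i) (λ a → ∑ L (λ b → f a))            ≡⟨ ∑-cong (digits i) constant ⟩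
        ∑ (digits i) (λ a → length L ℕ.* f a)           ≡⟨ ∑-*ˡ (digits i) (length L) f ⟩
        length L ℕ.* ∑ (digits i) f                     ≡⟨ cong (length L ℕ.*_) (∑-digits periodic i) ⟩
        length L ℕ.* (length L ^ i ℕ.* ∑ L f)           ≡⟨ ℕₚ.*-assoc (length L) _ _ ⟨
        length L ^ suc i ℕ.* ∑ L f                      ∎
        where
        open ≡.≡-Reasoning
        z = powR R t (suc i)
        a+zb≡a : ∀ a b → a + z * b ≡ a [mod P ]
        a+zb≡a a b = resp P (solve 3 (λ a z b → z :* b := a :+ z :* b :- a) ≈-refl a z b)
          (*∈ʳ P b (*∈ʳ P _ t∈P))
        constant : ∀ a → ∑ L (λ b → f a) ≡ length L ℕ.* f a
        constant a = ≡.trans (∑-cong L (λ _ → ≡.sym (ℕₚ.*-identityˡ (f a))))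
          (≡.trans (∑-*ʳ L (f a) (λ _ → 1)) (cong (ℕ._* f a) (∑-one L)))

  -- s r is the number of common neighbours in R/J of a clique of order r.
  Counted : Ideal R → (ℕ → ℕ) → Set (c ⊔ ℓ)
  Counted J s = ∃[ L ] (Complete J L ×
    (∀ us → PairwiseUnits J us → ∑ L (neighbours J us) ≡ s (length us)))

  -- For r > |R/P| the truncated difference is 0, which absorbs the case distinction in `Sfactor`.
  Sfactor≡ : ∀ r f → Sfactor R r f ≡ size (finite f) ^ (exponent f ∸ 1) ℕ.* (size (finite f) ∸ r)
  Sfactor≡ r f with r ≤ᵇ size (finite f) in eq
  ... | true  = refl
  ... | false = ≡.sym (≡.trans (cong (size (finite f) ^ (exponent f ∸ 1) ℕ.*_) (ℕₚ.m≤n⇒m∸n≡0 q≤r))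
                  (ℕₚ.*-zeroʳ (size (finite f) ^ (exponent f ∸ 1))))
    where
    q≤r : size (finite f) ≤ r
    q≤r = ℕₚ.≰⇒≥ λ r≤q → ≡.subst T eq (ℕₚ.≤⇒≤ᵇ r≤q)

  -- Units modulo Pⁿ are the units modulo `P`, so the indicator of common neighbours is periodic
  -- modulo `P` and `∑-digits` applies.
  counted-power : ∀ P (isPrime : IsPrime R P) (P≢0 : Nonzero R P) (Q : FiniteQuotient R P) n → 1 ≤ n →
    Counted (P ^ᴵ n) (λ r → size Q ^ (n ∸ 1) ℕ.* (size Q ∸ r))
  counted-power P isPrime P≢0 Q (suc i) _ =
    digits L L-complete i , complete-digits L L-complete i , count
    where
    open PrimePowerSystem P isPrime P≢0 (localUniformiser P isPrime P≢0 (∃-nearDivisor P isPrime P≢0))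
    open ≡.≡-Reasoning
    L = map (rep Q) (allFin (size Q))
    L-complete = complete-quotient Q
    length-L : length L ≡ size Q
    length-L = ≡.trans (length-map (rep Q) (allFin (size Q))) (length-tabulate {n = size Q} id)
    toP : ∀ {x} → UnitMod (P ^ᴵ suc i) x → UnitMod P x
    toP = unitMod-⊆ {P ^ᴵ suc i} {P} (·⊆ˡ P (P ^ᴵ i))
    count : ∀ us → PairwiseUnits (P ^ᴵ suc i) us →
      ∑ (digits L L-complete i) (neighbours (P ^ᴵ suc i) us) ≡ size Q ^ i ℕ.* (size Q ∸ length us)
    count us pairs = begin
      ∑ (digits L L-complete i) (neighbours (P ^ᴵ suc i) us)
        ≡⟨ ∑-cong (digits L L-complete i) (λ v → ind-cong (lem _) (lem _) (All.map toP) (All.map (unitMod-^ P (suc i)))) ⟩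
      ∑ (digits L L-complete i) (neighbours P us)
        ≡⟨ ∑-digits L L-complete (neighbours-periodic P us) i ⟩
      length L ^ i ℕ.* ∑ L (neighbours P us)
        ≡⟨ cong (length L ^ i ℕ.*_) (∑-neighbours-maximal P (isMaximal P isPrime P≢0) us (AllPairs.map toP pairs) L L-complete) ⟩
      length L ^ i ℕ.* (length L ∸ length us)
        ≡⟨ cong (λ q → q ^ i ℕ.* (q ∸ length us)) length-L ⟩
      size Q ^ i ℕ.* (size Q ∸ length us) ∎

  -- Distinct nonzero primes are maximal, hence comaximal; `comaximal-^` raises one side at a time,
  -- with a swap in between.
  comaximal-∏ : ∀ f fs → All (DistinctPrimes R f) fs → Comaximal (primePower f) (∏ fs)
  comaximal-∏ f []       []         = comaximal-whole (primePower f)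
  comaximal-∏ f (g ∷ gs) (f≢g ∷ f≢) = comaximal-· (primePower f) (primePower g) (∏ gs)
    (comaximal-^ (primePower f) (prime g) (exponent g)
      (comaximal-sym {prime g} {primePower f} (comaximal-^ (prime g) (prime f) (exponent f)
        (comaximal-sym {prime f} {prime g} (maximal-comaximal {prime f} {prime g} (max f) (max g) f≢g)))))
    (comaximal-∏ f gs f≢)
    where
    max : ∀ f → IsMaximal R (prime f)
    max f = isMaximal (prime f) (isPrime f) (nonzero f)

  counted-∏ : ∀ fs → AllPairs (DistinctPrimes R) fs → Counted (∏ fs) (λ r → S R r fs)
  -- Modulo the whole ring everything is a unit, so the single residue 0 is counted, matching the
  -- empty product.
  counted-∏ []       []                = 0# ∷ [] , complete-whole ,
    λ us _ → cong (ℕ._+ 0) (ind-yes (lem (AllUnits whole us 0#)) (All.universal (λ u → unitMod-whole (0# - u)) us))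
  counted-∏ (f ∷ fs) (f-fs ∷ distinct)
    with counted-power (prime f) (isPrime f) (nonzero f) (finite f) (exponent f) (exp≥1 f) | counted-∏ fs distinct
  ... | L , L-complete , L-count | L′ , L′-complete , L′-count =
    cartesianProductWith (ChineseRemainder.glue A B comax) L L′ ,
    ChineseRemainder.complete-glue A B comax L L′ L-complete L′-complete ,
    λ us pairs → ≡.trans (∑-neighbours-glue A B comax us L L′) (cong₂ ℕ._*_
      (≡.trans (L-count us (AllPairs.map (unitMod-⊆ {A · B} {A} (·⊆ˡ A B)) pairs)) (≡.sym (Sfactor≡ (length us) f)))
      (L′-count us (AllPairs.map (unitMod-⊆ {A · B} {B} (·⊆ʳ A B)) pairs)))
    where
    A = primePower f
    B = ∏ fs
    comax = comaximal-∏ f fs f-fs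

-- Counting cliques in the unitary Cayley graph.

module UnitaryCayleyGraph {c ℓ} (R : CommutativeRing c ℓ) (dedekind : IsDedekindDomain R)
  (I : Ideal R) (Q : FiniteQuotient R I) (nontrivial : 2 ≤ size Q) (F : Factorisation R I) where
  open CommutativeRing R using (_-_; 1#) renaming (refl to ≈-refl)
  open IntegerCoefficients R using (solve; _:=_; _:*_; _:-_; :1)
  open IdealLemmas R
  open ResidueSystems R dedekind
  open Classical R (proj₁ (proj₁ dedekind)) (proj₁ (proj₂ dedekind)) using (lem)
  open ≡.≡-Reasoning

  private
    n = size Q
    fs = factors F

  I⊆∏ : ∀ {x} → mem I x → mem (∏ fs) x
  I⊆∏ {x} m = ≡.subst (λ A → A x) (≡.sym (mem-∏ fs)) (proj₁ (equal F) x m)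

  ∏⊆I : ∀ {x} → mem (∏ fs) x → mem I x
  ∏⊆I {x} m = proj₂ (equal F) x (≡.subst (λ A → A x) (mem-∏ fs) m)

  -- Otherwise all residues would coincide. Properness is what makes adjacency irreflexive.
  1∉I : Proper R I
  1∉I 1∈I = distinct-points nontrivial all-equal
    where
    all-equal : (i j : Fin n) → i ≡ j
    all-equal i j = begin
      i             ≡⟨ proj₂ (surj Q i) ⟨
      π Q (rep Q i) ≡⟨ ker⇐ Q _ _ (resp I (solve 1 (λ d → d :* :1 := d) ≈-refl _) (*∈ I _ 1∈I)) ⟩
      π Q (rep Q j) ≡⟨ proj₂ (surj Q j) ⟩
      j             ∎
    distinct-points : ∀ {n} → 2 ≤ n → ¬ ((i j : Fin n) → i ≡ j)
    distinct-points (s≤s (s≤s _)) h with h Fin.zero (Fin.suc Fin.zero)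
    ... | ()

  adj⇒unit : ∀ {u v} → Adj Q u v → UnitMod I (rep Q u - rep Q v)
  adj⇒unit (z , e) = rep Q z , ker⇒ Q _ _ e

  -- `Adj` asks for an inverse among the chosen representatives, so y is replaced by the
  -- representative of its class.
  unit⇒adj : ∀ {u v} → UnitMod I (rep Q u - rep Q v) → Adj Q u v
  unit⇒adj {u} {v} (y , m) = π Q y , ker⇐ Q _ _ (resp I
    (solve 3 (λ d y z → (d :* y :- :1) :- d :* (y :- z) := d :* z :- :1) ≈-refl (rep Q u - rep Q v) y (rep Q (π Q y)))
    (+∈ I m (-∈ I (*∈ I (rep Q u - rep Q v) (ker⇒ Q y (rep Q (π Q y)) (≡.sym (proj₂ (surj Q (π Q y)))))))))

  adj-sym : ∀ {u v} → Adj Q u v → Adj Q v u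
  adj-sym {u} {v} uv = unit⇒adj (unitMod-neg I (adj⇒unit uv))

  adj-irrefl : ∀ {u} → ¬ Adj Q u u
  adj-irrefl {u} uu = unitMod⇒∉ I 1∉I (adj⇒unit uu) (mod-reflexive I ≈-refl)

  Clique : List (Fin n) → Set
  Clique = AllPairs (Adj Q)

  clique : List (Fin n) → ℕ
  clique C = ind (allPairs? (adj? Q) C)

  -- `AllPairs` takes each pair in list order, so invariance under permutation rests on the symmetry
  -- of adjacency.
  clique-↭ : ∀ {C D} → C ↭ D → clique C ≡ clique D
  clique-↭ C↭D = ind-cong (allPairs? (adj? Q) _) (allPairs? (adj? Q) _) (respects C↭D) (respects (Perm.↭-sym C↭D))
    where
    respects : ∀ {C D} → C ↭ D → Clique C → Clique D
    respects C↭D = Permₛ.AllPairs-resp-↭ (≡.setoid (Fin n)) adj-sym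
      ((λ { refl → id }) , (λ { refl → id })) (Perm.↭⇒↭ₛ C↭D)

  clique-rep : ∀ v C → clique (v ∷ v ∷ C) ≡ 0
  clique-rep v C = ind-no (allPairs? (adj? Q) (v ∷ v ∷ C)) λ { ((vv ∷ _) ∷ _) → adj-irrefl vv }

  -- Extending `C` to a clique means choosing a common neighbour. Their number does not depend on
  -- the residue system, so the sum moves from the representatives of `Q` to the system built from
  -- the factorisation.
  ∑-extensions : ∀ {C} → Clique C → ∑ (allFin n) (λ v → clique (v ∷ C)) ≡ S R (length C) fs
  ∑-extensions {C} C-clique with counted-∏ fs (distinct F)
  ... | L , L-complete , L-count = begin
    ∑ (allFin n) (λ v → clique (v ∷ C))
      ≡⟨ ∑-cong (allFin n) (λ v → ind-cong (allPairs? (adj? Q) (v ∷ C)) (lem (AllUnits I us (rep Q v)))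
           (λ { (vC ∷ _) → Allₚ.map⁺ (All.map adj⇒unit vC) })
           (λ m → All.map unit⇒adj (Allₚ.map⁻ m) ∷ C-clique)) ⟩
    ∑ (allFin n) (λ v → neighbours I us (rep Q v))
      ≡⟨ ∑-map (rep Q) (allFin n) (neighbours I us) ⟨
    ∑ (map (rep Q) (allFin n)) (neighbours I us)
      ≡⟨ ∑-complete-unique I (neighbours-periodic I us) (map (rep Q) (allFin n)) L (complete-quotient Q)
           (complete-resp {∏ fs} {I} ∏⊆I I⊆∏ L L-complete) ⟩
    ∑ L (neighbours I us)
      ≡⟨ ∑-cong L (λ v → ind-cong (lem (AllUnits I us v)) (lem (AllUnits (∏ fs) us v))
           (All.map (unitMod-⊆ {I} {∏ fs} I⊆∏)) (All.map (unitMod-⊆ {∏ fs} {I} ∏⊆I))) ⟩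
    ∑ L (neighbours (∏ fs) us)
      ≡⟨ L-count us (AllPairsₚ.map⁺ (AllPairs.map (unitMod-⊆ {I} {∏ fs} I⊆∏ ∘ adj⇒unit) C-clique)) ⟩
    S R (length us) fs
      ≡⟨ cong (λ k → S R k fs) (length-map (rep Q) C) ⟩
    S R (length C) fs ∎
    where
    us = map (rep Q) C

  -- Both sides vanish if `C` is not a clique, so the identity can be summed over all m-subsets.
  ∑-extensions-clique : ∀ C → ∑ (allFin n) (λ v → clique (v ∷ C)) ≡ clique C ℕ.* S R (length C) fs
  ∑-extensions-clique C = split (allPairs? (adj? Q) C)
    where
    split : (C? : Dec (Clique C)) → ∑ (allFin n) (λ v → clique (v ∷ C)) ≡ ind C? ℕ.* S R (length C) fs
    split (yes C-clique) = ≡.trans (∑-extensions C-clique) (≡.sym (ℕₚ.*-identityˡ _))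
    split (no ¬C) = ≡.trans
      (∑-cong (allFin n) λ v → ind-no (allPairs? (adj? Q) (v ∷ C)) λ { (_ ∷ C-clique) → ¬C C-clique })
      (∑-zero (allFin n))

  cliqueCount-suc : ∀ m → suc m ℕ.* cliqueCount Q (suc m) ≡ cliqueCount Q m ℕ.* S R m fs
  cliqueCount-suc m = begin
    suc m ℕ.* cliqueCount Q (suc m)
      ≡⟨ cong (suc m ℕ.*_) (∑-ind-filter (allPairs? (adj? Q)) (choose (allFin n) (suc m))) ⟩
    suc m ℕ.* ∑ (choose (allFin n) (suc m)) clique
      ≡⟨ ∑-choose-suc clique clique-↭ clique-rep (allFin n) m ⟩
    ∑ (choose (allFin n) m) (λ C → ∑ (allFin n) (λ v → clique (v ∷ C)))
      ≡⟨ ∑-cong-All (choose-length (allFin n) m) (λ {C} len →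
           ≡.trans (∑-extensions-clique C) (cong (λ k → clique C ℕ.* S R k fs) len)) ⟩
    ∑ (choose (allFin n) m) (λ C → clique C ℕ.* S R m fs)
      ≡⟨ ∑-*ʳ (choose (allFin n) m) (S R m fs) clique ⟩
    ∑ (choose (allFin n) m) clique ℕ.* S R m fs
      ≡⟨ cong (ℕ._* S R m fs) (∑-ind-filter (allPairs? (adj? Q)) (choose (allFin n) m)) ⟨
    cliqueCount Q m ℕ.* S R m fs ∎

  -- The denominators k are collected into m!, which keeps the identity in ℕ. The factor k = m + 1
  -- is S_m, hence the `k ∸ 1`.
  m!*cliqueCount : ∀ m → m ! ℕ.* cliqueCount Q m ≡ prod1to m (λ k → S R (k ∸ 1) fs)
  m!*cliqueCount zero    = refl
  m!*cliqueCount (suc m) = begin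
    suc m ! ℕ.* cliqueCount Q (suc m)          ≡⟨ cong (ℕ._* cliqueCount Q (suc m)) (ℕₚ.*-comm (suc m) (m !)) ⟩
    m ! ℕ.* suc m ℕ.* cliqueCount Q (suc m)    ≡⟨ ℕₚ.*-assoc (m !) (suc m) _ ⟩
    m ! ℕ.* (suc m ℕ.* cliqueCount Q (suc m))  ≡⟨ cong (m ! ℕ.*_) (cliqueCount-suc m) ⟩
    m ! ℕ.* (cliqueCount Q m ℕ.* S R m fs)     ≡⟨ ℕₚ.*-assoc (m !) _ _ ⟨
    m ! ℕ.* cliqueCount Q m ℕ.* S R m fs       ≡⟨ cong (ℕ._* S R m fs) (m!*cliqueCount m) ⟩
    prod1to (suc m) (λ k → S R (k ∸ 1) fs)     ∎

open import Data.Nat using (_*_)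

theorem3p1 : ∀ {c ℓ} (R : CommutativeRing c ℓ) → IsDedekindDomain R →
    (I : Ideal R) → Nonzero R I → (Q : FiniteQuotient R I) → 2 ≤ size Q →
    (F : Factorisation R I) →
    (m : ℕ) → 1 ≤ m →
    (m !) * cliqueCount Q m ≡ prod1to m (λ k → S R (k ∸ 1) (factors F))
theorem3p1 R dedekind I _ Q nontrivial F m _ = UnitaryCayleyGraph.m!*cliqueCount R dedekind I Q nontrivial F m
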